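{- For every index $\boldsymbol{k}$, \[q^{\boldsymbol{p}(\boldsymbol{p}+1)/2}\sum_{l\ge0}[\boldsymbol{p}]^l\,\zeta^\star_{\widehat{\mathcal{Q}}}(\{1\}^l,\boldsymbol{k})+\sum_{l\ge0}(q^{ -\boldsymbol{p}}[\boldsymbol{p}])^l\,\overline{\zeta}^\star_{\widehat{\mathcal{Q}}}(\{1\}^l,\boldsymbol{k}^\vee)=0\] in $\widehat{\mathcal{Q}}$, where $\{1\}^l$ denotes $l$ consecutive entries equal to $1$.
   Context: Indices. An index is a finite sequence of positive integers. For an index $\boldsymbol{k}$, Hoffman's dual $\boldsymbol{k}^\vee$ is obtained by writing each component $k_i$ as a sum $1+\cdots+1$ of ones and then interchanging commas and plus signs; for example $(3,1)^\vee=(1,1,2)$. $q$-sums. Let $[n]=(1-q^n)/(1-q)$. For an index $(k_1,\dots,k_d)$ set \[H^\star_m(\boldsymbol{k};q)=\sum_{m\ge m_1\ge\cdots\ge m_d>0}\prod_a\frac{q^{(k_a-1)m_a}}{[m_a]^{k_a}},\qquad \overline{H}^\star_m(\boldsymbol{k};q)=\sum_{m\ge m_1\ge\cdots\ge m_d>0}\prod_a\frac{q^{m_a}}{[m_a]^{k_a}}.\] The ring $\widehat{\mathcal{Q}}$. For a prime $p$, $\mathbb{Z}_{(p)}$ is the set of rationals whose denominator is prime to $p$, and $Z_{p,n}=\mathbb{Z}_{(p)}[q]/([p]^n)$. Set $\mathcal{Q}_n=(\prod_pZ_{p,n})/(\bigoplus_pZ_{p,n})$ and $\widehat{\mathcal{Q}}=\varprojlim_n\mathcal{Q}_n$;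 here $[m]$ is invertible in $Z_{p,n}$ for $1\le m<p$. Define \[\zeta^\star_{\widehat{\mathcal{Q}}}(\boldsymbol{k})=((H^\star_{p-1}(\boldsymbol{k};q)\bmod[p]^n)_p)_n,\qquad \overline{\zeta}^\star_{\widehat{\mathcal{Q}}}(\boldsymbol{k})=((\overline{H}^\star_{p-1}(\boldsymbol{k};q)\bmod[p]^n)_p)_n.\] Put $[\boldsymbol{p}]=(([p]\bmod[p]^n)_p)_n$ and $q^{ -\boldsymbol{p}}=(((q^p)^{ -1}\bmod[p]^n)_p)_n$ (note $q^p=1-(1-q)[p]$ is invertible modulo $[p]^n$). Put $q^{\boldsymbol{p}(\boldsymbol{p}+1)/2}=((q^{p(p+1)/2}\bmod[p]^n)_p)_n$. The ring $\widehat{\mathcal{Q}}$ is complete in the $[\boldsymbol{p}]$-adic topology. -}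

module Defs where

open import Data.Nat as ℕ using (ℕ; zero; suc; _∸_; _<_)
open import Data.Nat.Divisibility using (_∣_)
open import Data.Rational as ℚ using (ℚ; 0ℚ; 1ℚ)
open import Data.List using (List; []; _∷_; replicate; _++_; map)
open import Data.Bool using (Bool; true; false; not)
open import Data.Product using (Σ; _×_; _,_)
open import Relation.Nullary using (¬_)
open import Relation.Binary.PropositionalEquality using (_≡_)

-- Polynomials in q with rational coefficients (coefficient lists,
-- lowest degree first; trailing zeros allowed, equality is coefficientwise).

Poly : Set
Poly = List ℚ

coeff : Poly → ℕ → ℚ
coeff []       _       = 0ℚ
coeff (a ∷ as) zero    = a
coeff (a ∷ as) (suc i) = coeff as i

_≈ₚ_ : Poly → Poly → Set
x ≈ₚ y = ∀ i → coeff x i ≡ coeff y i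

infixl 6 _⊕_
infixl 7 _⊗_

_⊕_ : Poly → Poly → Poly
[]       ⊕ ys       = ys
(x ∷ xs) ⊕ []       = x ∷ xs
(x ∷ xs) ⊕ (y ∷ ys) = (x ℚ.+ y) ∷ (xs ⊕ ys)

neg : Poly → Poly
neg = map (λ x → ℚ.- x)

_⊗_ : Poly → Poly → Poly
[]       ⊗ ys = []
(x ∷ xs) ⊗ ys = map (x ℚ.*_) ys ⊕ (0ℚ ∷ (xs ⊗ ys))

one : Poly
one = 1ℚ ∷ []

qpow : ℕ → Poly
qpow m = replicate m 0ℚ ++ (1ℚ ∷ [])

_^ₚ_ : Poly → ℕ → Poly
f ^ₚ zero  = one
f ^ₚ suc e = f ⊗ (f ^ₚ e)

-- [m] = (1 - q^m)/(1 - q) = 1 + q + ... + q^(m-1)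
qint : ℕ → Poly
qint zero    = []
qint (suc m) = qint m ⊕ qpow m

InZp : ℕ → ℚ → Set
InZp p x = ¬ (p ∣ ℚ.denominatorℕ x)

InZpPoly : ℕ → Poly → Set
InZpPoly p c = ∀ i → InZp p (coeff c i)

-- Elements of Z_{p,n} = Z_(p)[q]/([p]^n) written as fractions a/s, where
-- s is a product of the units [m] (1 ≤ m < p) and q^p of Z_{p,n}.
-- (All denominators built below are of this form.)

record Frac : Set where
  constructor _/ₚ_
  field
    num : Poly
    den : Poly
open Frac public

infixl 6 _+F_
infixl 7 _*F_

_+F_ : Frac → Frac → Frac
(a /ₚ s) +F (b /ₚ t) = (a ⊗ t ⊕ b ⊗ s) /ₚ (s ⊗ t)

_*F_ : Frac → Frac → Frac
(a /ₚ s) *F (b /ₚ t) = (a ⊗ b) /ₚ (s ⊗ t)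

poly : Poly → Frac
poly a = a /ₚ one

0F 1F : Frac
0F = poly []
1F = poly one

_^F_ : Frac → ℕ → Frac
f ^F zero  = 1F
f ^F suc e = f *F (f ^F e)

-- a/s = b/t in Z_{p,n}: since s, t are units there, this holds iff
-- a t - b s ∈ [p]^n Z_(p)[q].
EqIn : ℕ → ℕ → Frac → Frac → Set
EqIn p n (a /ₚ s) (b /ₚ t) =
  Σ Poly (λ c → InZpPoly p c × ((a ⊗ t ⊕ neg (b ⊗ s)) ≈ₚ (c ⊗ (qint p ^ₚ n))))

sumTo : ℕ → (ℕ → Frac) → Frac
sumTo zero    f = 0F
sumTo (suc M) f = sumTo M f +F f (suc M)

sumBelow : ℕ → (ℕ → Frac) → Frac
sumBelow zero    f = 0F
sumBelow (suc L) f = sumBelow L f +F f L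

Hstar : ℕ → List ℕ → Frac
Hstar M []       = 1F
Hstar M (k ∷ ks) =
  sumTo M (λ m → (qpow ((k ∸ 1) ℕ.* m) /ₚ (qint m ^ₚ k)) *F Hstar m ks)

HbarStar : ℕ → List ℕ → Frac
HbarStar M []       = 1F
HbarStar M (k ∷ ks) =
  sumTo M (λ m → (qpow m /ₚ (qint m ^ₚ k)) *F HbarStar m ks)

-- Hoffman's dual.  Write k as 1 ? 1 ? ... ? 1 with each ? ∈ {+ (true), , (false)},
-- swap + and , and read off the new index.

toGaps : List ℕ → List Bool
toGaps []           = []
toGaps (k ∷ [])     = replicate (k ∸ 1) true
toGaps (k ∷ l ∷ ks) = replicate (k ∸ 1) true ++ (false ∷ toGaps (l ∷ ks))

fromGaps : ℕ → List Bool → List ℕ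
fromGaps acc []           = acc ∷ []
fromGaps acc (true ∷ gs)  = fromGaps (suc acc) gs
fromGaps acc (false ∷ gs) = acc ∷ fromGaps 1 gs

dual : List ℕ → List ℕ
dual ks = fromGaps 1 (map not (toGaps ks))

-- The n-th level, p-component of the left-hand side of Theorem 5.4.
-- Modulo [p]^n the terms with l ≥ n vanish (they carry [p]^l), so the
-- component of the [p]-adically convergent series is the partial sum over l < n.

qinvp : ℕ → Frac
qinvp p = one /ₚ qpow p

LHS : ℕ → ℕ → List ℕ → Frac
LHS p n ks =
  poly (qpow ((p ℕ.* suc p) ℕ./ 2))
    *F sumBelow n (λ l → (poly (qint p) ^F l) *F Hstar (p ∸ 1) (replicate l 1 ++ ks))
  +F sumBelow n (λ l → ((qinvp p *F poly (qint p)) ^F l)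
                         *F HbarStar (p ∸ 1) (replicate l 1 ++ dual ks))

-- Call t a table if t(b, a) = t(b + 1, a) + qᵇ t(b, a + 1). Its row t(0, ·) and column t(·, 0) determine each
-- other (they are inverse q-binomial transforms). If s and t are tables and Q + P = 1 + q P, then the two defects
--   t(b, a) + q [a] s(b, a − 1) + (P − [a + b + 1]) s(b, a)                         and
--   Q ([b] s(b − 1, a) + qᵃ⁺ᵇ t(b, a)) + (P − [a + b + 1]) s(b, a)
-- satisfy the same recursion up to a scalar, so once they vanish on one edge of the triangle a + b < N they vanish
-- inside it. With P = 0, Q = 1 this shows, one letter of the index at a time, that the outer summands of
-- H⋆(k) and H̄⋆(k^∨) below p are, up to powers of q, the row and the column of a single table t.
-- With P = [p], Q = qᵖ and N = p − 1 the vanishing edge encodes the recursion in m of Σ [p]ˡ H⋆ₘ({1}ˡ, k),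
-- respectively of Σ (q⁻ᵖ[p])ˡ H̄⋆ₘ({1}ˡ, k^∨). On the antidiagonal a + b = p − 1, where P − [a + b + 1] = 0,
-- the recursion carries one corner of the defect to the other; this expresses both series through t(p − 1, 0) and
-- t(0, p − 1), and for p odd the two expressions add up to zero.
--
-- No step divides by [p], so everything takes place in a ring where [p]ⁿ = 0 and [1], …, [p − 1], q are units.

module Submission where

open import Defs
open import Algebra.Bundles using (CommutativeRing; RawRing)
import Algebra.Solver.Ring
import Algebra.Solver.Ring.AlmostCommutativeRing as ACR
open import Data.Bool using (true; false; not)
open import Data.Integer as ℤ using (ℤ; +_)
import Data.Integer.Properties as ℤₚ
open import Data.List using (List; []; _∷_; _++_; map; replicate)
open import Data.List.Relation.Unary.All as All using (All; []; _∷_)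
open import Data.List.Relation.Unary.All.Properties using (map⁺)
open import Data.Maybe as Maybe using (Maybe)
open import Data.Nat as ℕ using (ℕ; zero; suc; _<_; _≤_; s≤s; z≤n)
open import Data.Nat.Coprimality as Coprimality using (Coprime; 1-coprimeTo; coprime-Bézout; prime⇒coprime)
open import Data.Nat.DivMod using (_%_; m%n<n; m≡m%n+[m/n]*n; m*n/n≡m)
open import Data.Nat.Divisibility using (∣1⇒≡1; m%n≡0⇒n∣m)
open import Data.Nat.GCD using (module Bézout)
open import Data.Nat.Primality using (Prime; prime⇒irreducible; ¬prime[1])
import Data.Nat.Properties as ℕₚ
open import Data.Nat.Solver using (module +-*-Solver)
open import Data.Product using (Σ; _×_; _,_; ∃-syntax; proj₁; proj₂)
open import Data.Rational as ℚ using (ℚ; 0ℚ; 1ℚ; mkℚ)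
import Data.Rational.Properties as ℚₚ
import Data.Rational.Unnormalised as ℚᵘ
import Data.Rational.Unnormalised.Properties as ℚᵘₚ
open import Data.Sum using (inj₂)
open import Function using (_∘_)
open import Level using (0ℓ; _⊔_)
open import Relation.Binary using (IsEquivalence; Setoid)
open import Relation.Binary.PropositionalEquality as ≡ using (_≡_; _≢_)
open import Relation.Nullary using (yes; no; contradiction)
open import Relation.Nullary.Decidable using (dec⇒maybe)

-- Normalising polynomial identities in a commutative ring

-- A coefficient (a , b) stands for the integer a − b.
module RingSolver {c ℓ} (R : CommutativeRing c ℓ) where
  open CommutativeRing R
  open import Algebra.Properties.Semiring.Mult.TCOptimised semiring using (×-homo-+; ×1-homo-*) renaming (_×_ to _·_)
  open import Algebra.Properties.Ring ring using (-‿+-comm; -‿distribˡ-*; -‿distribʳ-*; -0#≈0#; -‿involutive)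
  open import Relation.Binary.Reasoning.Setoid setoid
  open import Algebra.Properties.CommutativeSemigroup +-commutativeSemigroup using (interchange)

  private
    difference : RawRing _ _
    difference = record
      { Carrier = ℕ × ℕ
      ; _≈_     = _≡_
      ; _+_     = λ (a , b) (c , d) → a ℕ.+ c , b ℕ.+ d
      ; _*_     = λ (a , b) (c , d) → a ℕ.* c ℕ.+ b ℕ.* d , a ℕ.* d ℕ.+ b ℕ.* c
      ; -_      = λ (a , b) → b , a
      ; 0#      = 0 , 0
      ; 1#      = 1 , 0
      }

    -- The case `zero` is split off so that the constants 0 and 1 evaluate to `0#` and `1#` by
    -- computation, with no trailing `- 0#`.
    ⟦_⟧′ : ℕ × ℕ → Carrier
    ⟦ a , zero  ⟧′ = a · 1#
    ⟦ a , suc b ⟧′ = a · 1# - suc b · 1#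

    ⟦⟧′-difference : ∀ a b → ⟦ a , b ⟧′ ≈ a · 1# - b · 1#
    ⟦⟧′-difference a zero    = sym (trans (+-congˡ -0#≈0#) (+-identityʳ _))
    ⟦⟧′-difference a (suc b) = refl

    -‿interchange : ∀ w x y z → (w + x) - (y + z) ≈ (w - y) + (x - z)
    -‿interchange w x y z = trans (+-congˡ (sym (-‿+-comm y z))) (interchange w x (- y) (- z))

    +-homo : ∀ x y → ⟦ RawRing._+_ difference x y ⟧′ ≈ ⟦ x ⟧′ + ⟦ y ⟧′
    +-homo (a , b) (c , d) = begin
      ⟦ a ℕ.+ c , b ℕ.+ d ⟧′                      ≈⟨ ⟦⟧′-difference (a ℕ.+ c) (b ℕ.+ d) ⟩
      (a ℕ.+ c) · 1# - (b ℕ.+ d) · 1#             ≈⟨ +-cong (×-homo-+ 1# a c) (-‿cong (×-homo-+ 1# b d)) ⟩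
      (a · 1# + c · 1#) - (b · 1# + d · 1#)       ≈⟨ -‿interchange _ _ _ _ ⟩
      (a · 1# - b · 1#) + (c · 1# - d · 1#)       ≈⟨ +-cong (⟦⟧′-difference a b) (⟦⟧′-difference c d) ⟨
      ⟦ a , b ⟧′ + ⟦ c , d ⟧′                     ∎

    *-difference : ∀ w x y z → (w - x) * (y - z) ≈ (w * y + x * z) - (w * z + x * y)
    *-difference w x y z = begin
      (w - x) * (y - z)                             ≈⟨ distribʳ _ _ _ ⟩
      w * (y - z) + (- x) * (y - z)                 ≈⟨ +-cong (distribˡ _ _ _) (distribˡ _ _ _) ⟩
      (w * y + w * - z) + ((- x) * y + (- x) * - z) ≈⟨ +-cong (+-congˡ (-‿distribʳ-* w z)) (+-comm _ _) ⟨
      (w * y - w * z) + ((- x) * - z + (- x) * y)   ≈⟨ +-congˡ (+-cong -x*-z (sym (-‿distribˡ-* x y))) ⟩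
      (w * y - w * z) + (x * z - x * y)             ≈⟨ -‿interchange _ _ _ _ ⟨
      (w * y + x * z) - (w * z + x * y)             ∎
      where
      -x*-z : (- x) * - z ≈ x * z
      -x*-z = begin
        (- x) * - z   ≈⟨ -‿distribˡ-* x (- z) ⟨
        - (x * - z)   ≈⟨ -‿cong (-‿distribʳ-* x z) ⟨
        - (- (x * z)) ≈⟨ -‿involutive _ ⟩
        x * z         ∎

    *-homo : ∀ x y → ⟦ RawRing._*_ difference x y ⟧′ ≈ ⟦ x ⟧′ * ⟦ y ⟧′
    *-homo (a , b) (c , d) = begin
      ⟦ a ℕ.* c ℕ.+ b ℕ.* d , a ℕ.* d ℕ.+ b ℕ.* c ⟧′              ≈⟨ ⟦⟧′-difference (a ℕ.* c ℕ.+ b ℕ.* d) (a ℕ.* d ℕ.+ b ℕ.* c) ⟩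
      (a ℕ.* c ℕ.+ b ℕ.* d) · 1# - (a ℕ.* d ℕ.+ b ℕ.* c) · 1#     ≈⟨ +-cong (homo a c b d) (-‿cong (homo a d b c)) ⟩
      (a · 1# * c · 1# + b · 1# * d · 1#) - (a · 1# * d · 1# + b · 1# * c · 1#)
                                                                  ≈⟨ *-difference _ _ _ _ ⟨
      (a · 1# - b · 1#) * (c · 1# - d · 1#)                       ≈⟨ *-cong (⟦⟧′-difference a b) (⟦⟧′-difference c d) ⟨
      ⟦ a , b ⟧′ * ⟦ c , d ⟧′                                     ∎
      where
      homo : ∀ i j k l → (i ℕ.* j ℕ.+ k ℕ.* l) · 1# ≈ i · 1# * j · 1# + k · 1# * l · 1#
      homo i j k l = trans (×-homo-+ 1# (i ℕ.* j) (k ℕ.* l)) (+-cong (×1-homo-* i j) (×1-homo-* k l))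

    -‿homo : ∀ x → ⟦ RawRing.-_ difference x ⟧′ ≈ - ⟦ x ⟧′
    -‿homo (a , b) = begin
      ⟦ b , a ⟧′            ≈⟨ ⟦⟧′-difference b a ⟩
      b · 1# - a · 1#       ≈⟨ +-comm _ _ ⟩
      - (a · 1#) + b · 1#   ≈⟨ +-congˡ (-‿involutive _) ⟨
      - (a · 1#) - - (b · 1#) ≈⟨ -‿+-comm _ _ ⟩
      - (a · 1# - b · 1#)   ≈⟨ -‿cong (⟦⟧′-difference a b) ⟨
      - ⟦ a , b ⟧′          ∎

    morphism : difference ACR.-Raw-AlmostCommutative⟶ ACR.fromCommutativeRing R
    morphism = record
      { ⟦_⟧    = ⟦_⟧′
      ; +-homo = +-homo
      ; *-homo = *-homo
      ; -‿homo = -‿homo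
      ; 0-homo = refl
      ; 1-homo = refl
      }

    -- An integer has many representing pairs, so coefficients are compared crosswise. Adding the
    -- null pairs `(d , d)` and `(b , b)` turns the crosswise equation into one between equal pairs.
    ≈-of-differences : ∀ a b c d → a ℕ.+ d ≡ c ℕ.+ b → ⟦ a , b ⟧′ ≈ ⟦ c , d ⟧′
    ≈-of-differences a b c d eq = begin
      ⟦ a , b ⟧′                                      ≈⟨ +-identityʳ _ ⟨
      ⟦ a , b ⟧′ + 0#                                 ≈⟨ +-congˡ (-‿inverseʳ _) ⟨
      ⟦ a , b ⟧′ + (d · 1# - d · 1#)                  ≈⟨ +-congˡ (⟦⟧′-difference d d) ⟨
      ⟦ a , b ⟧′ + ⟦ d , d ⟧′                         ≈⟨ +-homo (a , b) (d , d) ⟨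
      ⟦ a ℕ.+ d , b ℕ.+ d ⟧′                          ≡⟨ ≡.cong₂ (λ x y → ⟦ x , y ⟧′) eq (ℕₚ.+-comm b d) ⟩
      ⟦ c ℕ.+ b , d ℕ.+ b ⟧′                          ≈⟨ +-homo (c , d) (b , b) ⟩
      ⟦ c , d ⟧′ + ⟦ b , b ⟧′                         ≈⟨ +-congˡ (⟦⟧′-difference b b) ⟩
      ⟦ c , d ⟧′ + (b · 1# - b · 1#)                  ≈⟨ +-congˡ (-‿inverseʳ _) ⟩
      ⟦ c , d ⟧′ + 0#                                 ≈⟨ +-identityʳ _ ⟩
      ⟦ c , d ⟧′                                      ∎

    _≟′_ : ∀ x y → Maybe (⟦ x ⟧′ ≈ ⟦ y ⟧′)
    (a , b) ≟′ (c , d) = Maybe.map (≈-of-differences a b c d) (dec⇒maybe (a ℕ.+ d ℕ.≟ c ℕ.+ b))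

  open Algebra.Solver.Ring difference (ACR.fromCommutativeRing R) morphism _≟′_ public
    using (solve; _:=_; _:+_; _:*_; _:-_; :-_; con; Polynomial)

  :1 : ∀ {n} → Polynomial n
  :1 = con (1 , 0)

-- q-numbers, tables and their two defects

module QTables {c ℓ} (R : CommutativeRing c ℓ) (q : CommutativeRing.Carrier R) where
  open CommutativeRing R
  open RingSolver R
  open import Algebra.Properties.Semiring.Exp semiring using (_^_; ^-homo-*) public
  open import Relation.Binary.Reasoning.Setoid setoid

  -- This is b(b - 1)/2, the power of q collected along an antidiagonal from row 0 to row b.
  triangle : ℕ → ℕ
  triangle zero    = 0
  triangle (suc b) = b ℕ.+ triangle b

  [_] : ℕ → Carrier
  [ zero  ] = 0#
  [ suc m ] = [ m ] + q ^ m

  InvertsBelow : ℕ → (ℕ → Carrier) → Set ℓ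
  InvertsBelow N i = ∀ m → m < N → [ suc m ] * i (suc m) ≈ 1#

  -- Both sides are [m + 1], with the last or the first power of q split off. At m = p this is the
  -- relation Q + P = 1 + q P for P = [p] and Q = qᵖ.
  q^-[] : ∀ m → q ^ m + [ m ] ≈ 1# + q * [ m ]
  q^-[] zero    = +-congˡ (sym (zeroʳ q))
  q^-[] (suc m) = begin
    q * q ^ m + ([ m ] + q ^ m)   ≈⟨ solve 3 (λ q u v → q :* u :+ (v :+ u) := (u :+ v) :+ q :* u) refl q (q ^ m) [ m ] ⟩
    (q ^ m + [ m ]) + q * q ^ m   ≈⟨ +-congʳ (q^-[] m) ⟩
    (1# + q * [ m ]) + q * q ^ m  ≈⟨ solve 3 (λ q u v → (:1 :+ q :* v) :+ q :* u := :1 :+ q :* (v :+ u)) refl q (q ^ m) [ m ] ⟩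
    1# + q * ([ m ] + q ^ m)      ∎

  [suc] : ∀ m → [ suc m ] ≈ 1# + q * [ m ]
  [suc] m = trans (+-comm _ _) (q^-[] m)

  -- The model is t b a = xᵃ (1 − x)(1 − q x)⋯(1 − qᵇ⁻¹ x), applied to a linear functional in x:
  -- the sequences t 0 a and t b 0 then form a pair of inverse q-binomial transforms.
  Twisted : Carrier → (ℕ → ℕ → Carrier) → Set ℓ
  Twisted x t = ∀ b a → x * t b a ≈ t (suc b) a + q ^ b * t b (suc a)

  Table : (ℕ → ℕ → Carrier) → Set ℓ
  Table = Twisted 1#

  module _ {t : ℕ → ℕ → Carrier} (t-table : Table t) where
    unfold : ∀ b a → t b a ≈ t (suc b) a + q ^ b * t b (suc a)
    unfold b a = trans (sym (*-identityˡ _)) (t-table b a)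

  scale-table : ∀ x {t} → Table t → Table (λ b a → x * t b a)
  scale-table x {t} t-table b a = begin
    1# * (x * t b a)                                 ≈⟨ *-identityˡ _ ⟩
    x * t b a                                        ≈⟨ *-congˡ (unfold t-table b a) ⟩
    x * (t (suc b) a + q ^ b * t b (suc a))          ≈⟨ solve 4 (λ x u v w → x :* (u :+ v :* w) := x :* u :+ v :* (x :* w)) refl _ _ _ _ ⟩
    x * t (suc b) a + q ^ b * (x * t b (suc a))      ∎

  fromRow : (ℕ → Carrier) → ℕ → ℕ → Carrier
  fromRow u zero    a = u a
  fromRow u (suc b) a = fromRow u b a - q ^ b * fromRow u b (suc a)

  fromRow-table : ∀ u → Table (fromRow u)
  fromRow-table u b a = solve 2 (λ x y → :1 :* x := (x :- y) :+ y) refl _ _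

  module _ (s : ℕ → ℕ → Carrier) where

    -- In the first clause the factor [0] = 0 removes the entry with index -1.
    shiftᵃ : ℕ → ℕ → Carrier
    shiftᵃ b zero    = 0#
    shiftᵃ b (suc a) = [ suc a ] * s b a

    shiftᵇ : ℕ → ℕ → Carrier
    shiftᵇ zero    a = 0#
    shiftᵇ (suc b) a = [ suc b ] * s b a

    module _ (s-table : Table s) where

      shiftᵃ-unfold : ∀ b a → shiftᵃ b a ≈ shiftᵃ (suc b) a + q ^ b * ([ a ] * s b a)
      shiftᵃ-unfold b zero    = solve 2 (λ x y → con (0 , 0) := con (0 , 0) :+ x :* (con (0 , 0) :* y)) refl _ _
      shiftᵃ-unfold b (suc a) = trans (*-congˡ (unfold s-table b a))
        (solve 4 (λ x u v w → x :* (u :+ v :* w) := x :* u :+ v :* (x :* w)) refl _ _ _ _)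

      shiftᵇ-unfold : ∀ b a → q * shiftᵇ b a ≈ q * [ b ] * s b a + q ^ b * shiftᵇ b (suc a)
      shiftᵇ-unfold zero    a = solve 2 (λ x y → x :* con (0 , 0) := x :* con (0 , 0) :* y :+ :1 :* con (0 , 0)) refl _ _
      shiftᵇ-unfold (suc b) a = trans (*-congˡ (*-congˡ (unfold s-table b a)))
        (solve 5 (λ q B u v w → q :* (B :* (u :+ v :* w)) := q :* B :* u :+ (q :* v) :* (B :* w)) refl _ _ _ _ _)

    module _ (t : ℕ → ℕ → Carrier) where

      -- With P = 0, its vanishing is a summation on the row, [a + 1] s(0, a) = t(0, a) + q [a] s(0,
      -- a - 1), and a division on the column, [b + 1] s(b, 0) = t(b, 0).
      raiseᵃ : Carrier → ℕ → ℕ → Carrier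
      raiseᵃ P b a = t b a + q * shiftᵃ b a + (P - [ suc (b ℕ.+ a) ]) * s b a

      -- With P = 0 and Q = 1 the roles are exchanged: division on the row and summation on the
      -- column. The two defects thus mirror the exchange of plus signs and commas in Hoffman's
      -- dual.
      raiseᵇ : Carrier → Carrier → ℕ → ℕ → Carrier
      raiseᵇ P Q b a = Q * (shiftᵇ b a + q ^ (b ℕ.+ a) * t b a) + (P - [ suc (b ℕ.+ a) ]) * s b a

  module _ {t s : ℕ → ℕ → Carrier} (t-table : Table t) (s-table : Table s) where

    -- By `shiftᵃ-unfold` the shifted term misses the table recursion only by [a] in place of
    -- [a + 1] = [a] + qᵃ. The missing qᵃ⁺ᵇ⁺¹ s(b, a) is what the passage from [a + b + 1] to
    -- [a + b + 2] contributes.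
    raiseᵃ-table : ∀ P → Table (raiseᵃ s t P)
    raiseᵃ-table P b a rewrite ℕₚ.+-suc b a = begin
      1# * (t b a + q * shiftᵃ s b a + (P - X) * s b a)
        ≈⟨ *-congˡ (+-cong (+-cong (unfold t-table b a) (*-congˡ (trans (shiftᵃ-unfold s s-table b a) (+-congˡ (*-congˡ (*-congˡ (unfold s-table b a)))))))
                   (*-congˡ (unfold s-table b a))) ⟩
      1# * ((T₁ + y * T₂) + q * (K + y * (A * (S₁ + y * S₂))) + (P - X) * (S₁ + y * S₂))
        ≈⟨ solve 11 (λ T₁ y T₂ q K A S₁ S₂ P X x →
             :1 :* ((T₁ :+ y :* T₂) :+ q :* (K :+ y :* (A :* (S₁ :+ y :* S₂))) :+ (P :- X) :* (S₁ :+ y :* S₂))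
             := (T₁ :+ q :* K :+ (P :- (X :+ q :* (y :* x))) :* S₁)
                :+ y :* (T₂ :+ q :* ((A :+ x) :* (S₁ :+ y :* S₂)) :+ (P :- (X :+ q :* (y :* x))) :* S₂))
             refl T₁ y T₂ q K A S₁ S₂ P X x ⟩
      (T₁ + q * K + (P - (X + q * (y * x))) * S₁) + y * (T₂ + q * ((A + x) * (S₁ + y * S₂)) + (P - (X + q * (y * x))) * S₂)
        ≈⟨ +-cong (+-congˡ (*-congʳ (+-congˡ (-‿cong X′))))
                  (*-congˡ (+-cong (+-congˡ (*-congˡ (*-congˡ (sym (unfold s-table b a))))) (*-congʳ (+-congˡ (-‿cong X′))))) ⟩
      (T₁ + q * K + (P - [ suc (suc (b ℕ.+ a)) ]) * S₁) + y * (T₂ + q * ((A + x) * s b a) + (P - [ suc (suc (b ℕ.+ a)) ]) * S₂) ∎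
      where
      T₁ = t (suc b) a
      T₂ = t b (suc a)
      S₁ = s (suc b) a
      S₂ = s b (suc a)
      K = shiftᵃ s (suc b) a
      A = [ a ]
      X = [ suc (b ℕ.+ a) ]
      y = q ^ b
      x = q ^ a
      X′ : X + q * (y * x) ≈ [ suc (suc (b ℕ.+ a)) ]
      X′ = +-congˡ (*-congˡ (sym (^-homo-* q b a)))

    -- The scalar q turns P - [m] into Q + P - [m + 1], by the hypothesis and [m + 1] = 1 + q [m].
    -- The surplus Q s(b, a) then completes q [b] to [b + 1].
    raiseᵇ-twisted : ∀ {P Q} → Q + P ≈ 1# + q * P → Twisted q (raiseᵇ s t P Q)
    raiseᵇ-twisted {P} {Q} PQ b a rewrite ℕₚ.+-suc b a = begin
      q * (Q * (shiftᵇ s b a + W * t b a) + (P - X) * s b a)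
        ≈⟨ solve 7 (λ q Q K Wt P X s → q :* (Q :* (K :+ Wt) :+ (P :- X) :* s) := Q :* (q :* K :+ q :* Wt) :+ ((:1 :+ q :* P) :- (:1 :+ q :* X)) :* s)
             refl q Q (shiftᵇ s b a) (W * t b a) P X (s b a) ⟩
      Q * (q * shiftᵇ s b a + q * (W * t b a)) + ((1# + q * P) - (1# + q * X)) * s b a
        ≈⟨ +-cong (*-congˡ (+-cong (trans (shiftᵇ-unfold s s-table b a) (+-congʳ (*-congˡ (unfold s-table b a)))) (*-congˡ (*-congˡ (unfold t-table b a)))))
                  (*-cong (+-cong (sym PQ) (-‿cong (sym ([suc] (suc (b ℕ.+ a)))))) (unfold s-table b a)) ⟩
      Q * ((q * B * (S₁ + y * S₂) + y * K) + q * (W * (T₁ + y * T₂))) + ((Q + P) - X′) * (S₁ + y * S₂)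
        ≈⟨ solve 12 (λ Q q B S₁ y S₂ K W T₁ T₂ P X′ →
             Q :* ((q :* B :* (S₁ :+ y :* S₂) :+ y :* K) :+ q :* (W :* (T₁ :+ y :* T₂))) :+ ((Q :+ P) :- X′) :* (S₁ :+ y :* S₂)
             := (Q :* ((:1 :+ q :* B) :* (S₁ :+ y :* S₂) :+ (q :* W) :* T₁) :+ (P :- X′) :* S₁)
                :+ y :* (Q :* (K :+ (q :* W) :* T₂) :+ (P :- X′) :* S₂))
             refl Q q B S₁ y S₂ K W T₁ T₂ P X′ ⟩
      (Q * ((1# + q * B) * (S₁ + y * S₂) + (q * W) * T₁) + (P - X′) * S₁) + y * (Q * (K + (q * W) * T₂) + (P - X′) * S₂)
        ≈⟨ +-congʳ (+-congʳ (*-congˡ (+-congʳ (*-cong (sym ([suc] b)) (sym (unfold s-table b a)))))) ⟩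
      (Q * ([ suc b ] * s b a + (q * W) * T₁) + (P - X′) * S₁) + y * (Q * (K + (q * W) * T₂) + (P - X′) * S₂) ∎
      where
      T₁ = t (suc b) a
      T₂ = t b (suc a)
      S₁ = s (suc b) a
      S₂ = s b (suc a)
      K = shiftᵇ s b (suc a)
      B = [ b ]
      W = q ^ (b ℕ.+ a)
      X = [ suc (b ℕ.+ a) ]
      X′ = [ suc (suc (b ℕ.+ a)) ]
      y = q ^ b

  module _ {x : Carrier} {e : ℕ → ℕ → Carrier} (e-twisted : Twisted x e) where

    next-row : ∀ b a → e (suc b) a ≈ x * e b a - q ^ b * e b (suc a)
    next-row b a = trans (solve 2 (λ u v → u := (u :+ v) :- v) refl _ _) (+-congʳ (sym (e-twisted b a)))

    -- An entry of row b + 1 is computed from two entries of row b whose index sums do not exceed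
    -- its own, so the induction on b stays inside the triangle.
    vanish-from-row : ∀ {N} → (∀ a → a < N → e 0 a ≈ 0#) → ∀ b a → b ℕ.+ a < N → e b a ≈ 0#
    vanish-from-row e₀ zero    a a<N = e₀ a a<N
    vanish-from-row {N} e₀ (suc b) a ba<N = begin
      e (suc b) a                        ≈⟨ next-row b a ⟩
      x * e b a - q ^ b * e b (suc a)    ≈⟨ +-cong (*-congˡ (vanish-from-row e₀ b a (ℕₚ.<-trans (ℕₚ.n<1+n _) ba<N)))
                                                   (-‿cong (*-congˡ (vanish-from-row e₀ b (suc a) (≡.subst (_< N) (≡.sym (ℕₚ.+-suc b a)) ba<N)))) ⟩
      x * 0# - q ^ b * 0#                ≈⟨ solve 2 (λ u v → u :* con (0 , 0) :- v :* con (0 , 0) := con (0 , 0)) refl _ _ ⟩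
      0#                                 ∎

    -- As the entries inside the triangle vanish, the recursion leaves e(b + 1, a) = -qᵇ e(b, a + 1)
    -- on its edge. The factors multiply up to (-1)ᵇ q^(b(b - 1)/2).
    antidiagonal : ∀ {N} → (∀ b a → b ℕ.+ a < N → e b a ≈ 0#) →
                   ∀ b a → b ℕ.+ a ≡ N → e b a ≈ (- 1#) ^ b * (q ^ triangle b * e 0 N)
    antidiagonal e≈0 zero    a ≡.refl = solve 1 (λ u → u := :1 :* (:1 :* u)) refl _
    antidiagonal {N} e≈0 (suc b) a ba≡N = begin
      e (suc b) a                        ≈⟨ next-row b a ⟩
      x * e b a - q ^ b * e b (suc a)    ≈⟨ +-cong (*-congˡ (e≈0 b a (≡.subst (b ℕ.+ a <_) ba≡N (ℕₚ.n<1+n _))))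
                                                   (-‿cong (*-congˡ (antidiagonal e≈0 b (suc a) (≡.trans (ℕₚ.+-suc b a) ba≡N)))) ⟩
      x * 0# - q ^ b * ((- 1#) ^ b * (q ^ triangle b * e 0 N))
        ≈⟨ solve 5 (λ x u s v w → x :* con (0 , 0) :- u :* (s :* (v :* w)) := ((:- :1) :* s) :* ((u :* v) :* w)) refl _ _ _ _ _ ⟩
      (- 1#) ^ suc b * ((q ^ b * q ^ triangle b) * e 0 N)   ≈⟨ *-congˡ (*-congʳ (^-homo-* q b (triangle b))) ⟨
      (- 1#) ^ suc b * (q ^ triangle (suc b) * e 0 N) ∎

    -- Evenness of N removes the sign. With N = p - 1 this is where p has to be odd.
    antidiagonal-even : ∀ j {N} → N ≡ j ℕ.* 2 → (∀ b a → b ℕ.+ a < N → e b a ≈ 0#) → e N 0 ≈ q ^ triangle N * e 0 N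
    antidiagonal-even j {N} ≡.refl e≈0 = begin
      e N 0                                       ≈⟨ antidiagonal e≈0 N 0 (ℕₚ.+-identityʳ N) ⟩
      (- 1#) ^ N * (q ^ triangle N * e 0 N)       ≈⟨ *-congʳ (sign j) ⟩
      1# * (q ^ triangle N * e 0 N)               ≈⟨ *-identityˡ _ ⟩
      q ^ triangle N * e 0 N                      ∎
      where
      sign : ∀ j → (- 1#) ^ (j ℕ.* 2) ≈ 1#
      sign zero    = refl
      sign (suc j) = trans (solve 1 (λ u → (:- :1) :* ((:- :1) :* u) := u) refl _) (sign j)

  module Invertible (q⁻¹ : Carrier) (q-inv : q * q⁻¹ ≈ 1#) where

    q^-inv : ∀ m → q ^ m * q⁻¹ ^ m ≈ 1#
    q^-inv zero    = *-identityˡ _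
    q^-inv (suc m) = begin
      (q * q ^ m) * (q⁻¹ * q⁻¹ ^ m)   ≈⟨ solve 4 (λ u v w z → (u :* v) :* (w :* z) := (u :* w) :* (v :* z)) refl _ _ _ _ ⟩
      (q * q⁻¹) * (q ^ m * q⁻¹ ^ m)   ≈⟨ *-cong q-inv (q^-inv m) ⟩
      1# * 1#                         ≈⟨ *-identityˡ _ ⟩
      1#                              ∎

    q^-cancel : ∀ m {x y} → q ^ m * x ≈ q ^ m * y → x ≈ y
    q^-cancel m {x} {y} eq = begin
      x                          ≈⟨ un x ⟨
      q⁻¹ ^ m * (q ^ m * x)      ≈⟨ *-congˡ eq ⟩
      q⁻¹ ^ m * (q ^ m * y)      ≈⟨ un y ⟩
      y                          ∎
      where
      un : ∀ z → q⁻¹ ^ m * (q ^ m * z) ≈ z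
      un z = trans (solve 3 (λ u v z → u :* (v :* z) := (v :* u) :* z) refl _ _ z) (trans (*-congʳ (q^-inv m)) (*-identityˡ z))

    fromColumn : (ℕ → Carrier) → ℕ → ℕ → Carrier
    fromColumn v b zero    = v b
    fromColumn v b (suc a) = q⁻¹ ^ b * (fromColumn v b a - fromColumn v (suc b) a)

    fromColumn-table : ∀ v → Table (fromColumn v)
    fromColumn-table v b a = sym (begin
      t₁ + q ^ b * (q⁻¹ ^ b * (t - t₁))     ≈⟨ +-congˡ (*-assoc _ _ _) ⟨
      t₁ + (q ^ b * q⁻¹ ^ b) * (t - t₁)     ≈⟨ +-congˡ (*-congʳ (q^-inv b)) ⟩
      t₁ + 1# * (t - t₁)                    ≈⟨ solve 2 (λ u v → v :+ :1 :* (u :- v) := :1 :* u) refl t t₁ ⟩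
      1# * t                                ∎)
      where
      t = fromColumn v b a
      t₁ = fromColumn v (suc b) a

    -- Moving away from the column determines only qᵇ e(b, a + 1), so, unlike for the row, q has to
    -- be invertible.
    vanish-from-column : ∀ {x e N} → Twisted x e → (∀ b → b < N → e b 0 ≈ 0#) → ∀ b a → b ℕ.+ a < N → e b a ≈ 0#
    vanish-from-column {N = N} e-twisted e₀ b zero b<N = e₀ b (≡.subst (_< N) (ℕₚ.+-identityʳ b) b<N)
    vanish-from-column {x} {e} {N} e-twisted e₀ b (suc a) ba<N = q^-cancel b (begin
      q ^ b * e b (suc a)               ≈⟨ solve 2 (λ u v → v := (u :+ v) :- u) refl (e (suc b) a) _ ⟩
      (e (suc b) a + q ^ b * e b (suc a)) - e (suc b) a  ≈⟨ +-congʳ (e-twisted b a) ⟨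
      x * e b a - e (suc b) a           ≈⟨ +-cong (*-congˡ (vanish-from-column e-twisted e₀ b a (ℕₚ.<-trans (ℕₚ.n<1+n _) ba<N′)))
                                                  (-‿cong (vanish-from-column e-twisted e₀ (suc b) a ba<N′)) ⟩
      x * 0# - 0#                       ≈⟨ solve 2 (λ u v → u :* con (0 , 0) :- con (0 , 0) := v :* con (0 , 0)) refl _ (q ^ b) ⟩
      q ^ b * 0#                        ∎)
      where
      ba<N′ : suc (b ℕ.+ a) < N
      ba<N′ = ≡.subst (_< N) (ℕₚ.+-suc b a) ba<N

-- Hoffman's dual, read from the first letter

dual-suc : ∀ k ks → dual (suc (suc k) ∷ ks) ≡ 1 ∷ dual (suc k ∷ ks)
dual-suc k []       = ≡.refl
dual-suc k (l ∷ ks) = ≡.refl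

-- The accumulator enters only the first component that is read off, hence one more unit in it
-- changes nothing else.
fromGaps-suc : ∀ acc gs → ∃[ j ] ∃[ l ] (fromGaps acc gs ≡ j ∷ l × fromGaps (suc acc) gs ≡ suc j ∷ l)
fromGaps-suc acc []           = acc , [] , ≡.refl , ≡.refl
fromGaps-suc acc (true ∷ gs)  = fromGaps-suc (suc acc) gs
fromGaps-suc acc (false ∷ gs) = acc , fromGaps 1 gs , ≡.refl , ≡.refl

-- A leading 1 is followed by a comma. The dual has a plus sign there, which lengthens its first
-- component instead of adding one.
dual-1∷ : ∀ k ks → ∃[ j ] ∃[ l ] (dual (k ∷ ks) ≡ j ∷ l × dual (1 ∷ k ∷ ks) ≡ suc j ∷ l)
dual-1∷ k ks = fromGaps-suc 1 (map not (toGaps (k ∷ ks)))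

-- Star sums and their truncated generating series

module StarSums {c ℓ} (R : CommutativeRing c ℓ) where
  open CommutativeRing R
  open RingSolver R
  open import Algebra.Properties.Semiring.Exp semiring using (_^_)
  open import Relation.Binary.Reasoning.Setoid setoid

  sum₁ : ℕ → (ℕ → Carrier) → Carrier
  sum₁ zero    f = 0#
  sum₁ (suc M) f = sum₁ M f + f (suc M)

  sum₀ : ℕ → (ℕ → Carrier) → Carrier
  sum₀ zero    f = 0#
  sum₀ (suc L) f = sum₀ L f + f L

  -- Both H⋆ and H̄⋆ have the form Σ ∏ g(kₐ, mₐ).
  module _ (g : ℕ → ℕ → Carrier) where

    star : ℕ → List ℕ → Carrier
    star M []       = 1#
    star M (k ∷ ks) = sum₁ M (λ m → g k m * star m ks)

    -- For m > 0 this is the increment of `star` from m - 1 to m, that is, the summand with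
    -- outermost variable m. For the empty index `star` is constant, hence 0.
    slice : List ℕ → ℕ → Carrier
    slice []       m = 0#
    slice (k ∷ ks) m = g k m * star m ks

    series : Carrier → ℕ → List ℕ → ℕ → Carrier
    series x n ks M = sum₀ n (λ l → x ^ l * star M (replicate l 1 ++ ks))

    series-0 : ∀ x n k ks → series x n (k ∷ ks) 0 ≈ 0#
    series-0 x zero    k ks = refl
    series-0 x (suc n) k ks = begin
      series x n (k ∷ ks) 0 + x ^ n * star 0 (replicate n 1 ++ k ∷ ks)  ≈⟨ +-cong (series-0 x n k ks) (*-congˡ (star-0 n)) ⟩
      0# + x ^ n * 0#                                                  ≈⟨ trans (+-identityˡ _) (zeroʳ _) ⟩
      0#                                                               ∎
      where
      star-0 : ∀ n → star 0 (replicate n 1 ++ k ∷ ks) ≈ 0#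
      star-0 zero    = refl
      star-0 (suc n) = refl

    -- In the l-th term, the summand with m₁ = M + 1 has lost one leading 1. Hence the last series
    -- on the right carries a factor x and has one term fewer.
    series-partial : ∀ x n k ks M →
      series x (suc n) (k ∷ ks) (suc M) ≈
      series x (suc n) (k ∷ ks) M + slice (k ∷ ks) (suc M) + x * (g 1 (suc M) * series x n (k ∷ ks) (suc M))
    series-partial x zero k ks M =
      solve 4 (λ u v x w → con (0 , 0) :+ :1 :* (u :+ v) := con (0 , 0) :+ :1 :* u :+ v :+ x :* (w :* con (0 , 0))) refl _ _ x (g 1 (suc M))
    series-partial x (suc n) k ks M = begin
      series x (suc n) (k ∷ ks) (suc M) + x * x ^ n * (Z + G * Y)     ≈⟨ +-congʳ (series-partial x n k ks M) ⟩
      (S + V + x * (G * U)) + x * x ^ n * (Z + G * Y)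
        ≈⟨ solve 8 (λ x xⁿ S V U Z G Y → (S :+ V :+ x :* (G :* U)) :+ x :* xⁿ :* (Z :+ G :* Y)
                     := (S :+ x :* xⁿ :* Z) :+ V :+ x :* (G :* (U :+ xⁿ :* Y)))
             refl x (x ^ n) S V U Z G Y ⟩
      (S + x * x ^ n * Z) + V + x * (G * (U + x ^ n * Y))             ∎
      where
      S = series x (suc n) (k ∷ ks) M
      U = series x n (k ∷ ks) (suc M)
      V = slice (k ∷ ks) (suc M)
      G = g 1 (suc M)
      Y = star (suc M) (replicate n 1 ++ k ∷ ks)
      Z = star M (replicate (suc n) 1 ++ k ∷ ks)

    -- When xⁿ = 0 the two lengths of truncation agree, and the recursion in M closes up on a single
    -- series.
    series-suc : ∀ {x n} → x ^ n ≈ 0# → ∀ k ks M →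
      series x n (k ∷ ks) (suc M) ≈
      series x n (k ∷ ks) M + slice (k ∷ ks) (suc M) + x * (g 1 (suc M) * series x n (k ∷ ks) (suc M))
    series-suc {x} {n} xⁿ≈0 k ks M = begin
      series x n (k ∷ ks) (suc M)         ≈⟨ drop-last (suc M) ⟨
      series x (suc n) (k ∷ ks) (suc M)   ≈⟨ series-partial x n k ks M ⟩
      series x (suc n) (k ∷ ks) M + _ + _ ≈⟨ +-congʳ (+-congʳ (drop-last M)) ⟩
      series x n (k ∷ ks) M + _ + _       ∎
      where
      drop-last : ∀ M → series x (suc n) (k ∷ ks) M ≈ series x n (k ∷ ks) M
      drop-last M = trans (+-congˡ (trans (*-congʳ xⁿ≈0) (zeroˡ _))) (+-identityʳ _)

-- Dual tables, built one letter at a time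

module Duality {c ℓ} (R : CommutativeRing c ℓ) (q : CommutativeRing.Carrier R)
  (N : ℕ) (i : ℕ → CommutativeRing.Carrier R) (i-inv : QTables.InvertsBelow R q N i) where

  open CommutativeRing R
  open QTables R q
  open RingSolver R
  open StarSums R
  open import Algebra.Properties.CommutativeSemiring.Exp commutativeSemiring using (^-distrib-*)
  open import Relation.Binary.Reasoning.Setoid setoid

  w w̄ : ℕ → ℕ → Carrier
  w k m = q ^ ((k ℕ.∸ 1) ℕ.* m) * i m ^ k
  w̄ k m = q ^ m * i m ^ k

  *-i-cancel : ∀ {m} → m < N → ∀ x → x ≈ [ suc m ] * (i (suc m) * x)
  *-i-cancel {m} m<N x = trans (trans (sym (*-identityˡ x)) (*-congʳ (sym (i-inv m m<N)))) (*-assoc _ _ _)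

  slice-suc : ∀ k ks m → slice w (suc (suc k) ∷ ks) m ≈ q ^ m * (i m * slice w (suc k ∷ ks) m)
  slice-suc k ks m = trans (*-congʳ (*-congʳ (^-homo-* q m (k ℕ.* m))))
    (solve 5 (λ a b c d e → ((a :* b) :* (c :* d)) :* e := a :* (c :* ((b :* d) :* e))) refl (q ^ m) (q ^ (k ℕ.* m)) (i m) (i m ^ suc k) (star w m ks))

  slice-1∷ : ∀ ks m → slice w (1 ∷ ks) m ≈ i m * star w m ks
  slice-1∷ ks m = solve 2 (λ c e → (:1 :* (c :* :1)) :* e := c :* e) refl (i m) (star w m ks)

  slicē-suc : ∀ k ks m → slice w̄ (suc k ∷ ks) m ≈ i m * slice w̄ (k ∷ ks) m
  slicē-suc k ks m = solve 4 (λ a c d e → (a :* (c :* d)) :* e := c :* ((a :* d) :* e)) refl (q ^ m) (i m) (i m ^ k) (star w̄ m ks)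

  slicē-1∷ : ∀ ks m → slice w̄ (1 ∷ ks) m ≈ q ^ m * (i m * star w̄ m ks)
  slicē-1∷ ks m = solve 3 (λ a c e → (a :* (c :* :1)) :* e := a :* (c :* e)) refl (q ^ m) (i m) (star w̄ m ks)

  -- Table indices start at 0 and summation variables at 1, hence the shift by one. Only the first N
  -- entries are prescribed, since [m] is inverted only for 1 ≤ m ≤ N.
  record DualTable (ks l : List ℕ) : Set (c ⊔ ℓ) where
    field
      t       : ℕ → ℕ → Carrier
      t-table : Table t
      row     : ∀ a → a < N → t 0 a ≈ q ^ suc a * slice w ks (suc a)
      column  : ∀ b → b < N → slice w̄ l (suc b) ≈ q ^ b * t b 0


  open DualTable

  -- Dividing the row by [a + 1] amounts to summing the column: with P = 0 and Q = 1 the defect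
  -- `raiseᵇ` vanishes on the row, hence also on the column. `S` is abstract so as to cover both the
  -- constant 1 needed for the index (1) and the sums H̄⋆.
  raise-row : ∀ {t s} → Table t → Table s → (∀ a → a < N → s 0 a ≈ q ^ suc a * (i (suc a) * t 0 a)) →
              (S : ℕ → Carrier) → S 0 ≈ 0# → (∀ b → b < N → S (suc b) ≈ S b + q ^ b * t b 0) →
              ∀ b → b < N → s b 0 ≈ i (suc b) * (q * S (suc b))
  raise-row {t} {s} t-table s-table row S S-0 S-suc b b<N = begin
    s b 0                                 ≈⟨ *-i-cancel b<N _ ⟩
    [ suc b ] * (i (suc b) * s b 0)       ≈⟨ solve 3 (λ u v w → u :* (v :* w) := v :* (u :* w)) refl _ _ _ ⟩
    i (suc b) * ([ suc b ] * s b 0)       ≈⟨ *-congˡ (s-column b b<N) ⟩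
    i (suc b) * (q * S (suc b))           ∎
    where
    -- Scaling by q absorbs the difference between `q ^ suc a` in the row hypothesis and `q ^ a` in
    -- the defect.
    t′ : ℕ → ℕ → Carrier
    t′ b a = q * t b a

    e : ℕ → ℕ → Carrier
    e = raiseᵇ s t′ 0# 1#

    e-row : ∀ a → a < N → e 0 a ≈ 0#
    e-row a a<N = begin
      1# * (0# + q ^ a * (q * t 0 a)) + (0# - [ suc a ]) * s 0 a
        ≈⟨ +-congˡ (*-congˡ (row a a<N)) ⟩
      1# * (0# + q ^ a * (q * t 0 a)) + (0# - [ suc a ]) * (q ^ suc a * (i (suc a) * t 0 a))
        ≈⟨ solve 5 (λ q x m j t → :1 :* (con (0 , 0) :+ x :* (q :* t)) :+ (con (0 , 0) :- m) :* ((q :* x) :* (j :* t))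
                     := (q :* x) :* (t :- m :* (j :* t))) refl q (q ^ a) [ suc a ] (i (suc a)) (t 0 a) ⟩
      q ^ suc a * (t 0 a - [ suc a ] * (i (suc a) * t 0 a))   ≈⟨ *-congˡ (+-congˡ (-‿cong (*-i-cancel a<N _))) ⟨
      q ^ suc a * (t 0 a - t 0 a)                             ≈⟨ solve 2 (λ x y → x :* (y :- y) := con (0 , 0)) refl _ _ ⟩
      0# ∎

    e-column : ∀ b → b < N → e b 0 ≈ 0#
    e-column b b<N = vanish-from-row
      (raiseᵇ-twisted (scale-table q {t} t-table) s-table (solve 1 (λ x → :1 :+ con (0 , 0) := :1 :+ x :* con (0 , 0)) refl q))
      e-row b 0 (≡.subst (_< N) (≡.sym (ℕₚ.+-identityʳ b)) b<N)

    shift : ∀ b → b < N → [ suc b ] * s b 0 ≈ shiftᵇ s b 0 + q * (q ^ b * t b 0)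
    shift b b<N = begin
      [ suc b ] * s b 0
        ≈⟨ solve 6 (λ K x q t m s → m :* s := (K :+ q :* (x :* t)) :- (:1 :* (K :+ x :* (q :* t)) :+ (con (0 , 0) :- m) :* s))
             refl (shiftᵇ s b 0) (q ^ b) q (t b 0) [ suc b ] (s b 0) ⟩
      (shiftᵇ s b 0 + q * (q ^ b * t b 0)) - (1# * (shiftᵇ s b 0 + q ^ b * (q * t b 0)) + (0# - [ suc b ]) * s b 0)
        ≈⟨ +-congˡ (-‿cong (≡.subst (λ m → 1# * (shiftᵇ s b 0 + q ^ m * (q * t b 0)) + (0# - [ suc m ]) * s b 0 ≈ 0#)
                                    (ℕₚ.+-identityʳ b) (e-column b b<N))) ⟩
      (shiftᵇ s b 0 + q * (q ^ b * t b 0)) - 0#   ≈⟨ solve 1 (λ u → u :- con (0 , 0) := u) refl _ ⟩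
      shiftᵇ s b 0 + q * (q ^ b * t b 0) ∎

    s-column : ∀ b → b < N → [ suc b ] * s b 0 ≈ q * S (suc b)
    s-column b b<N = trans (shift b b<N) (begin
      shiftᵇ s b 0 + q * (q ^ b * t b 0)   ≈⟨ +-congʳ (previous b b<N) ⟩
      q * S b + q * (q ^ b * t b 0)        ≈⟨ distribˡ _ _ _ ⟨
      q * (S b + q ^ b * t b 0)            ≈⟨ *-congˡ (S-suc b b<N) ⟨
      q * S (suc b)                        ∎)
      where
      previous : ∀ b → b < N → shiftᵇ s b 0 ≈ q * S b
      previous zero    _   = sym (trans (*-congˡ S-0) (zeroʳ _))
      previous (suc b) b<N = s-column b (ℕₚ.<-trans (ℕₚ.n<1+n b) b<N)

  dualTable-[1] : DualTable (1 ∷ []) (1 ∷ [])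
  dualTable-[1] = record
    { t       = fromRow u
    ; t-table = fromRow-table u
    ; row     = λ a a<N → refl
    ; column  = λ b b<N → begin
        slice w̄ (1 ∷ []) (suc b)                           ≈⟨ slicē-1∷ [] (suc b) ⟩
        q * q ^ b * (i (suc b) * 1#)                       ≈⟨ solve 3 (λ q x j → q :* x :* (j :* :1) := x :* (j :* (q :* :1))) refl _ _ _ ⟩
        q ^ b * (i (suc b) * (q * 1#))                     ≈⟨ *-congˡ (raise-row ones-table (fromRow-table u)
                                                                (λ a _ → *-congˡ (slice-1∷ [] (suc a))) S refl S-suc b b<N) ⟨
        q ^ b * fromRow u b 0                              ∎
    }
    where
    u : ℕ → Carrier
    u a = q ^ suc a * slice w (1 ∷ []) (suc a)

    -- The model table evaluated at x = 1: every product containing the factor 1 - x vanishes. It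
    -- plays the part of the empty index.
    ones : ℕ → ℕ → Carrier
    ones zero    a = 1#
    ones (suc b) a = 0#

    ones-table : Table ones
    ones-table zero    a = solve 0 (:1 :* :1 := con (0 , 0) :+ :1 :* :1) refl
    ones-table (suc b) a = solve 1 (λ x → :1 :* con (0 , 0) := con (0 , 0) :+ x :* con (0 , 0)) refl _

    S : ℕ → Carrier
    S zero    = 0#
    S (suc b) = 1#

    S-suc : ∀ b → b < N → S (suc b) ≈ S b + q ^ b * ones b 0
    S-suc zero    _ = solve 0 (:1 := con (0 , 0) :+ :1 :* :1) refl
    S-suc (suc b) _ = solve 1 (λ x → :1 := :1 :+ x :* con (0 , 0)) refl _

  -- A further plus sign multiplies the row by q^(a + 1)/[a + 1]. By `raise-row` the column is then
  -- summed, which is the effect of a new leading 1 in the dual.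
  dualTable-suc : ∀ {k ks j l} → DualTable (suc k ∷ ks) (j ∷ l) → DualTable (suc (suc k) ∷ ks) (1 ∷ j ∷ l)
  dualTable-suc {k} {ks} {j} {l} T = record
    { t       = fromRow u
    ; t-table = fromRow-table u
    ; row     = λ a a<N → refl
    ; column  = λ b b<N → begin
        slice w̄ (1 ∷ j ∷ l) (suc b)                               ≈⟨ slicē-1∷ (j ∷ l) (suc b) ⟩
        q * q ^ b * (i (suc b) * star w̄ (suc b) (j ∷ l))          ≈⟨ solve 4 (λ q x j s → q :* x :* (j :* s) := x :* (j :* (q :* s))) refl q _ _ _ ⟩
        q ^ b * (i (suc b) * (q * star w̄ (suc b) (j ∷ l)))        ≈⟨ *-congˡ (raise-row (t-table T) (fromRow-table u) u-row
                                                                       (λ b → star w̄ b (j ∷ l)) refl (λ b b<N → +-congˡ (column T b b<N)) b b<N) ⟨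
        q ^ b * fromRow u b 0                                     ∎
    }
    where
    u : ℕ → Carrier
    u a = q ^ suc a * slice w (suc (suc k) ∷ ks) (suc a)

    u-row : ∀ a → a < N → u a ≈ q ^ suc a * (i (suc a) * t T 0 a)
    u-row a a<N = *-congˡ (begin
      slice w (suc (suc k) ∷ ks) (suc a)                        ≈⟨ slice-suc k ks (suc a) ⟩
      q ^ suc a * (i (suc a) * slice w (suc k ∷ ks) (suc a))    ≈⟨ solve 3 (λ u v w → u :* (v :* w) := v :* (u :* w)) refl _ _ _ ⟩
      i (suc a) * (q ^ suc a * slice w (suc k ∷ ks) (suc a))    ≈⟨ *-congˡ (row T a a<N) ⟨
      i (suc a) * t T 0 a                                       ∎)

  -- The opposite exchange, through `raiseᵃ` with P = 0: a new leading 1 sums the row, and the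
  -- column is divided by [b + 1], which enlarges the first component of the dual.
  dualTable-1∷ : ∀ {k ks j l} → DualTable (k ∷ ks) (j ∷ l) → DualTable (1 ∷ k ∷ ks) (suc j ∷ l)
  dualTable-1∷ {k} {ks} {j} {l} T = record
    { t       = s
    ; t-table = fromRow-table u
    ; row     = λ a a<N → refl
    ; column  = λ b b<N → begin
        slice w̄ (suc j ∷ l) (suc b)                  ≈⟨ slicē-suc j l (suc b) ⟩
        i (suc b) * slice w̄ (j ∷ l) (suc b)          ≈⟨ *-congˡ (column T b b<N) ⟩
        i (suc b) * (q ^ b * t T b 0)                ≈⟨ *-congˡ (*-congˡ (s-column b b<N)) ⟩
        i (suc b) * (q ^ b * ([ suc b ] * s b 0))    ≈⟨ solve 4 (λ j x m s → j :* (x :* (m :* s)) := m :* (j :* (x :* s))) refl _ _ _ _ ⟩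
        [ suc b ] * (i (suc b) * (q ^ b * s b 0))    ≈⟨ *-i-cancel b<N _ ⟨
        q ^ b * s b 0                                ∎
    }
    where
    u : ℕ → Carrier
    u a = q ^ suc a * slice w (1 ∷ k ∷ ks) (suc a)

    s : ℕ → ℕ → Carrier
    s = fromRow u

    H : ℕ → Carrier
    H m = star w m (k ∷ ks)

    [suc]-u : ∀ a → a < N → [ suc a ] * u a ≈ q ^ suc a * H (suc a)
    [suc]-u a a<N = begin
      [ suc a ] * u a                                    ≈⟨ *-congˡ (*-congˡ (slice-1∷ (k ∷ ks) (suc a))) ⟩
      [ suc a ] * (q ^ suc a * (i (suc a) * H (suc a)))  ≈⟨ solve 4 (λ m x j h → m :* (x :* (j :* h)) := m :* (j :* (x :* h))) refl _ _ _ _ ⟩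
      [ suc a ] * (i (suc a) * (q ^ suc a * H (suc a)))  ≈⟨ *-i-cancel a<N _ ⟨
      q ^ suc a * H (suc a)                              ∎

    previous : ∀ a → a < N → shiftᵃ s 0 a ≈ q ^ a * H a
    previous zero    _   = sym (zeroʳ _)
    previous (suc a) a<N = [suc]-u a (ℕₚ.<-trans (ℕₚ.n<1+n a) a<N)

    e : ℕ → ℕ → Carrier
    e = raiseᵃ s (t T) 0#

    e-row : ∀ a → a < N → e 0 a ≈ 0#
    e-row a a<N = begin
      t T 0 a + q * shiftᵃ s 0 a + (0# - [ suc a ]) * u a
        ≈⟨ +-cong (+-cong (row T a a<N) (*-congˡ (previous a a<N)))
                  (trans (solve 2 (λ m u → (con (0 , 0) :- m) :* u := :- (m :* u)) refl _ _) (-‿cong ([suc]-u a a<N))) ⟩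
      q ^ suc a * V + q * (q ^ a * H a) - q ^ suc a * (H a + V)
        ≈⟨ solve 4 (λ q x V H → (q :* x) :* V :+ q :* (x :* H) :- (q :* x) :* (H :+ V) := con (0 , 0)) refl q (q ^ a) V (H a) ⟩
      0# ∎
      where V = slice w (k ∷ ks) (suc a)

    s-column : ∀ b → b < N → t T b 0 ≈ [ suc b ] * s b 0
    s-column b b<N = begin
      t T b 0                                                          ≈⟨ solve 4 (λ t q m s → t := (t :+ q :* con (0 , 0) :+ (con (0 , 0) :- m) :* s) :+ m :* s) refl _ q _ _ ⟩
      (t T b 0 + q * 0# + (0# - [ suc b ]) * s b 0) + [ suc b ] * s b 0 ≈⟨ +-congʳ e-column ⟩
      0# + [ suc b ] * s b 0                                           ≈⟨ +-identityˡ _ ⟩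
      [ suc b ] * s b 0                                                ∎
      where
      e-column : t T b 0 + q * 0# + (0# - [ suc b ]) * s b 0 ≈ 0#
      e-column = ≡.subst (λ m → t T b 0 + q * 0# + (0# - [ suc m ]) * s b 0 ≈ 0#) (ℕₚ.+-identityʳ b)
        (vanish-from-row (raiseᵃ-table (t-table T) (fromRow-table u) 0#) e-row b 0 (≡.subst (_< N) (≡.sym (ℕₚ.+-identityʳ b)) b<N))

  dualTable : ∀ k ks → All (1 ≤_) (suc k ∷ ks) → DualTable (suc k ∷ ks) (dual (suc k ∷ ks))
  dualTable zero    []           _              = dualTable-[1]
  dualTable zero    (zero ∷ ks)  (_ ∷ () ∷ _)
  dualTable zero    (suc l ∷ ks) (_ ∷ ks>0) with dual-1∷ (suc l) ks | dualTable l ks ks>0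
  ... | j , js , eq , eq′ | T = ≡.subst (DualTable _) (≡.sym eq′) (dualTable-1∷ (≡.subst (DualTable _) eq T))
  dualTable (suc k) ks           (_ ∷ ks>0) with dual-1∷ (suc k) ks | dualTable k ks (s≤s z≤n ∷ ks>0)
  ... | j , js , eq , _ | T = ≡.subst (DualTable _) (≡.sym (≡.trans (dual-suc k ks) (≡.cong (1 ∷_) eq))) (dualTable-suc (≡.subst (DualTable _) eq T))

  -- The two series modulo [p]ⁿ, with p = N + 1

  module _ (q⁻¹ : Carrier) (q-inv : q * q⁻¹ ≈ 1#) (n : ℕ) ([p]ⁿ≈0 : [ suc N ] ^ n ≈ 0#) (j₀ : ℕ) (N-even : N ≡ j₀ ℕ.* 2) where
    open Invertible q⁻¹ q-inv

    P Q x̄ : Carrier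
    P = [ suc N ]
    Q = q ^ suc N
    x̄ = q⁻¹ ^ suc N * P

    x̄ⁿ≈0 : x̄ ^ n ≈ 0#
    x̄ⁿ≈0 = trans (^-distrib-* (q⁻¹ ^ suc N) P n) (trans (*-congˡ [p]ⁿ≈0) (zeroʳ _))

    module _ {k ks j l} (T : DualTable (k ∷ ks) (j ∷ l)) where

      F F̄ : ℕ → Carrier
      F = series w P n (k ∷ ks)
      F̄ = series w̄ x̄ n (j ∷ l)

      -- Take s with row q^(a + 1) F(a + 1)/[a + 1]. For P = [p], vanishing of `raiseᵃ` on the row
      -- is the recursion `series-suc` for F. The two corners of the antidiagonal then relate t(N,
      -- 0) to t(0, N) and F(N).
      F-corner : t T N 0 ≈ q ^ triangle N * (t T 0 N + Q * F N)
      F-corner = begin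
        t T N 0                                         ≈⟨ solve 4 (λ t q p s → t := t :+ q :* con (0 , 0) :+ (p :- p) :* s) refl _ q P (s N 0) ⟩
        t T N 0 + q * 0# + (P - [ suc N ]) * s N 0      ≡⟨ ≡.cong (λ m → t T N 0 + q * 0# + (P - [ suc m ]) * s N 0) (ℕₚ.+-identityʳ N) ⟨
        e N 0                                           ≈⟨ antidiagonal-even e-table j₀ N-even (vanish-from-row e-table e-row) ⟩
        q ^ triangle N * e 0 N                          ≈⟨ *-congˡ (+-congʳ (+-congˡ (*-congˡ (shift N ℕₚ.≤-refl)))) ⟩
        -- The entry `s 0 N` contains `i (suc N)`, about which nothing is assumed; it is harmless
        -- because its factor is `P - P`.
        q ^ triangle N * (t T 0 N + q * (q ^ N * F N) + (P - P) * s 0 N)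
          ≈⟨ *-congˡ (solve 6 (λ t q x f p s → t :+ q :* (x :* f) :+ (p :- p) :* s := t :+ (q :* x) :* f) refl _ _ _ _ _ _) ⟩
        q ^ triangle N * (t T 0 N + Q * F N)            ∎
        where
        u : ℕ → Carrier
        u a = q ^ suc a * (i (suc a) * F (suc a))

        s e : ℕ → ℕ → Carrier
        s = fromRow u
        e = raiseᵃ s (t T) P

        e-table : Table e
        e-table = raiseᵃ-table (t-table T) (fromRow-table u) P

        [suc]-u : ∀ a → a < N → [ suc a ] * u a ≈ q ^ suc a * F (suc a)
        [suc]-u a a<N = trans (solve 4 (λ m x j h → m :* (x :* (j :* h)) := m :* (j :* (x :* h))) refl _ _ _ _) (sym (*-i-cancel a<N _))

        shift : ∀ a → a ≤ N → shiftᵃ s 0 a ≈ q ^ a * F a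
        shift zero    _   = sym (trans (*-identityˡ _) (series-0 w P n k ks))
        shift (suc a) a<N = [suc]-u a a<N

        e-row : ∀ a → a < N → e 0 a ≈ 0#
        e-row a a<N = begin
          t T 0 a + q * shiftᵃ s 0 a + (P - [ suc a ]) * u a
            ≈⟨ +-cong (+-cong (row T a a<N) (*-congˡ (shift a (ℕₚ.<⇒≤ a<N))))
                      (trans (solve 3 (λ p m u → (p :- m) :* u := p :* u :- m :* u) refl _ _ _) (+-congˡ (-‿cong ([suc]-u a a<N)))) ⟩
          q ^ suc a * V + q * (q ^ a * F a) + (P * u a - q ^ suc a * F (suc a))
            ≈⟨ +-congˡ (+-congˡ (-‿cong (*-congˡ (series-suc w {n = n} [p]ⁿ≈0 k ks a)))) ⟩
          q ^ suc a * V + q * (q ^ a * F a) + (P * u a - q ^ suc a * (F a + V + P * (w 1 (suc a) * F (suc a))))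
            ≈⟨ solve 7 (λ q x V F p j F′ → (q :* x) :* V :+ q :* (x :* F) :+ (p :* ((q :* x) :* (j :* F′)) :- (q :* x) :* (F :+ V :+ p :* (:1 :* (j :* :1) :* F′)))
                         := con (0 , 0)) refl q (q ^ a) V (F a) P (i (suc a)) (F (suc a)) ⟩
          0# ∎
          where V = slice w (k ∷ ks) (suc a)

      -- Here the column of r is F̄(b + 1)/[b + 1], and the recursion of F̄ is the vanishing of
      -- `raiseᵇ` on the column for P = [p], Q = qᵖ. Both corners carry a factor Q, which is
      -- cancelled.
      F̄-corner : F̄ N + q ^ N * t T N 0 ≈ q ^ triangle N * (q ^ N * t T 0 N)
      F̄-corner = q^-cancel (suc N) (begin
        Q * (F̄ N + q ^ N * t T N 0)                                             ≈⟨ *-congˡ (+-congʳ (shift N ℕₚ.≤-refl)) ⟨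
        Q * (shiftᵇ r N 0 + q ^ N * t T N 0)                                    ≈⟨ solve 3 (λ u p r → u := u :+ (p :- p) :* r) refl _ P (r N 0) ⟩
        Q * (shiftᵇ r N 0 + q ^ N * t T N 0) + (P - P) * r N 0                  ≡⟨ e-column≡ N ⟨
        e N 0                                                                   ≈⟨ antidiagonal-even e-twisted j₀ N-even
                                                                                     (vanish-from-column e-twisted e-column) ⟩
        q ^ triangle N * (Q * (0# + q ^ N * t T 0 N) + (P - P) * r 0 N)
          ≈⟨ solve 5 (λ z Q u p r → z :* (Q :* (con (0 , 0) :+ u) :+ (p :- p) :* r) := Q :* (z :* u)) refl _ _ _ _ _ ⟩
        Q * (q ^ triangle N * (q ^ N * t T 0 N))                                ∎)
        where
        v : ℕ → Carrier
        v b = i (suc b) * F̄ (suc b)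

        r e : ℕ → ℕ → Carrier
        r = fromColumn v
        e = raiseᵇ r (t T) P Q

        e-twisted : Twisted q e
        e-twisted = raiseᵇ-twisted (t-table T) (fromColumn-table v) (q^-[] (suc N))

        e-column≡ : ∀ b → e b 0 ≡ Q * (shiftᵇ r b 0 + q ^ b * t T b 0) + (P - [ suc b ]) * r b 0
        e-column≡ b = ≡.cong (λ m → Q * (shiftᵇ r b 0 + q ^ m * t T b 0) + (P - [ suc m ]) * r b 0) (ℕₚ.+-identityʳ b)

        shift : ∀ b → b ≤ N → shiftᵇ r b 0 ≈ F̄ b
        shift zero    _   = sym (series-0 w̄ x̄ n j l)
        shift (suc b) b<N = sym (*-i-cancel b<N _)

        F̄-suc : ∀ b → F̄ b + slice w̄ (j ∷ l) (suc b) ≈ F̄ (suc b) - x̄ * (q ^ suc b * v b)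
        F̄-suc b = begin
          F̄ b + V̄                                                                          ≈⟨ solve 2 (λ u v → u := (u :+ v) :- v) refl _ _ ⟩
          (F̄ b + V̄ + x̄ * (w̄ 1 (suc b) * F̄ (suc b))) - x̄ * (w̄ 1 (suc b) * F̄ (suc b))    ≈⟨ +-congʳ (series-suc w̄ {n = n} x̄ⁿ≈0 j l b) ⟨
          F̄ (suc b) - x̄ * (w̄ 1 (suc b) * F̄ (suc b))
            ≈⟨ solve 4 (λ f x y j → f :- x :* (y :* (j :* :1) :* f) := f :- x :* (y :* (j :* f))) refl _ _ _ _ ⟩
          F̄ (suc b) - x̄ * (q ^ suc b * v b)                                                ∎
          where V̄ = slice w̄ (j ∷ l) (suc b)

        e-column : ∀ b → b < N → e b 0 ≈ 0#
        e-column b b<N = begin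
          e b 0                                                                    ≡⟨ e-column≡ b ⟩
          Q * (shiftᵇ r b 0 + q ^ b * t T b 0) + (P - m) * v b                     ≈⟨ +-congʳ (*-congˡ (+-cong (shift b (ℕₚ.<⇒≤ b<N)) (sym (column T b b<N)))) ⟩
          Q * (F̄ b + slice w̄ (j ∷ l) (suc b)) + (P - m) * v b                      ≈⟨ +-congʳ (*-congˡ (trans (F̄-suc b) (+-congʳ (*-i-cancel b<N _)))) ⟩
          Q * (m * v b - x̄ * (q ^ suc b * v b)) + (P - m) * v b
            -- Terms are added and subtracted so that Q + P, Q Q⁻¹ and q^(b + 1) + [b + 1] appear as
            -- subterms. Replacing them by 1 + q P, 1 and 1 + q [b + 1] leaves a polynomial
            -- identity.
            ≈⟨ solve 6 (λ Q m v Q⁻¹ p z → Q :* (m :* v :- (Q⁻¹ :* p) :* (z :* v)) :+ (p :- m) :* v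
                         := (((Q :+ p) :- p :- :1) :* m :- (Q :* Q⁻¹) :* p :* ((z :+ m) :- m) :+ p) :* v) refl Q m (v b) (q⁻¹ ^ suc N) P (q ^ suc b) ⟩
          (((Q + P) - P - 1#) * m - (Q * q⁻¹ ^ suc N) * P * ((q ^ suc b + m) - m) + P) * v b
            ≈⟨ *-congʳ (+-congʳ (+-cong (*-congʳ (+-congʳ (+-congʳ (q^-[] (suc N))))) (-‿cong (*-cong (*-congʳ (q^-inv (suc N))) (+-congʳ (q^-[] (suc b))))))) ⟩
          (((1# + q * P) - P - 1#) * m - 1# * P * ((1# + q * m) - m) + P) * v b
            ≈⟨ solve 4 (λ q p m v → (((:1 :+ q :* p) :- p :- :1) :* m :- :1 :* p :* ((:1 :+ q :* m) :- m) :+ p) :* v := con (0 , 0)) refl q P m (v b) ⟩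
          0# ∎
          where m = [ suc b ]

      -- Eliminating t(N, 0) between the two corner formulas also cancels t(0, N), so no trace of
      -- the table remains.
      series-duality : q ^ (triangle N ℕ.+ (suc N ℕ.+ N)) * F N + F̄ N ≈ 0#
      series-duality = begin
        q ^ (triangle N ℕ.+ (suc N ℕ.+ N)) * F N + F̄ N
          ≈⟨ +-congʳ (*-congʳ (trans (^-homo-* q (triangle N) _) (*-congˡ (^-homo-* q (suc N) N)))) ⟩
        z * (Q * q ^ N) * F N + F̄ N
          ≈⟨ solve 7 (λ z Q y f f̄ t₀ t₁ → z :* (Q :* y) :* f :+ f̄ := (f̄ :+ y :* t₁) :+ y :* (z :* (t₀ :+ Q :* f) :- t₁) :- z :* (y :* t₀))
               refl z Q (q ^ N) (F N) (F̄ N) (t T 0 N) (t T N 0) ⟩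
        (F̄ N + q ^ N * t T N 0) + q ^ N * (z * (t T 0 N + Q * F N) - t T N 0) - z * (q ^ N * t T 0 N)
          ≈⟨ +-congʳ (+-cong F̄-corner (*-congˡ (+-congʳ (sym F-corner)))) ⟩
        z * (q ^ N * t T 0 N) + q ^ N * (t T N 0 - t T N 0) - z * (q ^ N * t T 0 N)
          ≈⟨ solve 3 (λ a y b → a :+ y :* (b :- b) :- a := con (0 , 0)) refl _ _ _ ⟩
        0# ∎
        where z = q ^ triangle N

-- Units modulo a power of [p]

module Units {c ℓ} (R : CommutativeRing c ℓ) where
  open CommutativeRing R
  open RingSolver R
  open StarSums R using (sum₀)
  open import Algebra.Properties.CommutativeSemiring.Exp commutativeSemiring using (_^_; ^-distrib-*)
  open import Relation.Binary.Reasoning.Setoid setoid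

  Unit : Carrier → Set (c ⊔ ℓ)
  Unit x = ∃[ y ] x * y ≈ 1#

  geometric-sum : ∀ z n → (1# - z) * sum₀ n (z ^_) + z ^ n ≈ 1#
  geometric-sum z zero    = solve 1 (λ z → (:1 :- z) :* con (0 , 0) :+ :1 := :1) refl z
  geometric-sum z (suc n) = trans
    (solve 3 (λ z s u → (:1 :- z) :* (s :+ u) :+ z :* u := (:1 :- z) :* s :+ u) refl z _ (z ^ n))
    (geometric-sum z n)

  -- Here x u = 1 - P v with P v nilpotent, and a finite geometric sum inverts 1 - P v.
  unit-mod-nilpotent : ∀ {x P} n → P ^ n ≈ 0# → ∀ u v → x * u + P * v ≈ 1# → Unit x
  unit-mod-nilpotent {x} {P} n Pⁿ≈0 u v eq = u * g , (begin
    x * (u * g)                    ≈⟨ solve 4 (λ x u g w → x :* (u :* g) := (x :* u :+ w :- w) :* g) refl x u g (P * v) ⟩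
    (x * u + P * v - P * v) * g    ≈⟨ *-congʳ (+-congʳ eq) ⟩
    (1# - P * v) * g               ≈⟨ +-identityʳ _ ⟨
    (1# - P * v) * g + 0#          ≈⟨ +-congˡ (trans (^-distrib-* P v n) (trans (*-congʳ Pⁿ≈0) (zeroˡ _))) ⟨
    (1# - P * v) * g + (P * v) ^ n ≈⟨ geometric-sum (P * v) n ⟩
    1#                             ∎)
    where g = sum₀ n ((P * v) ^_)

  unit-factor : ∀ {x y} → Unit (x * y) → Unit x
  unit-factor {x} {y} (u , xyu) = y * u , trans (sym (*-assoc x y u)) xyu

  module QUnits (q : Carrier) (p n : ℕ) (p-prime : Prime p) ([p]ⁿ≈0 : QTables.[_] R q p ^ n ≈ 0#) where
    open QTables R q using ([_]; [suc]; q^-[])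

    []-+ : ∀ m k → [ m ℕ.+ k ] ≈ [ m ] + q ^ m * [ k ]
    []-+ zero    k = solve 1 (λ x → x := con (0 , 0) :+ :1 :* x) refl _
    []-+ (suc m) k = begin
      [ suc (m ℕ.+ k) ]                       ≈⟨ [suc] (m ℕ.+ k) ⟩
      1# + q * [ m ℕ.+ k ]                    ≈⟨ +-congˡ (*-congˡ ([]-+ m k)) ⟩
      1# + q * ([ m ] + q ^ m * [ k ])        ≈⟨ solve 4 (λ q m x k → :1 :+ q :* (m :+ x :* k) := (:1 :+ q :* m) :+ (q :* x) :* k) refl q _ _ _ ⟩
      (1# + q * [ m ]) + q * q ^ m * [ k ]    ≈⟨ +-congʳ ([suc] m) ⟨
      [ suc m ] + q ^ suc m * [ k ]           ∎

    []-multiple : ∀ k m → ∃[ y ] [ k ℕ.* m ] ≈ [ m ] * y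
    []-multiple zero    m = 0# , sym (zeroʳ _)
    []-multiple (suc k) m with []-multiple k m
    ... | y , eq = 1# + q ^ m * y , (begin
      [ m ℕ.+ k ℕ.* m ]                   ≈⟨ []-+ m (k ℕ.* m) ⟩
      [ m ] + q ^ m * [ k ℕ.* m ]         ≈⟨ +-congˡ (*-congˡ eq) ⟩
      [ m ] + q ^ m * ([ m ] * y)         ≈⟨ solve 3 (λ m x y → m :+ x :* (m :* y) := m :* (:1 :+ x :* y)) refl _ _ _ ⟩
      [ m ] * (1# + q ^ m * y)            ∎)

    -- The integer relation lifts to [l j] = 1 + q [k m], where [l j] is a multiple of [j] and [k m]
    -- one of [m].
    []-bézout : ∀ k m l j → 1 ℕ.+ k ℕ.* m ≡ l ℕ.* j → ∃[ y ] ∃[ z ] [ j ] * y + [ m ] * z ≈ 1#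
    []-bézout k m l j eq with []-multiple k m | []-multiple l j
    ... | y , y-eq | z , z-eq = z , (- q) * y , (begin
      [ j ] * z + [ m ] * ((- q) * y)      ≈⟨ +-congʳ z-eq ⟨
      [ l ℕ.* j ] + [ m ] * ((- q) * y)    ≡⟨ ≡.cong (λ k → [ k ] + [ m ] * ((- q) * y)) eq ⟨
      [ suc (k ℕ.* m) ] + [ m ] * ((- q) * y)          ≈⟨ +-congʳ ([suc] (k ℕ.* m)) ⟩
      (1# + q * [ k ℕ.* m ]) + [ m ] * ((- q) * y)     ≈⟨ +-congʳ (+-congˡ (*-congˡ y-eq)) ⟩
      (1# + q * ([ m ] * y)) + [ m ] * ((- q) * y)     ≈⟨ solve 3 (λ q m y → (:1 :+ q :* (m :* y)) :+ m :* ((:- q) :* y) := :1) refl q _ _ ⟩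
      1# ∎)

    []-coprime : ∀ {m} → Coprime m p → ∃[ y ] ∃[ z ] [ m ] * y + [ p ] * z ≈ 1#
    []-coprime {m} m⊥p with coprime-Bézout m⊥p
    ... | Bézout.+- l k eq = []-bézout k p l m eq
    ... | Bézout.-+ k l eq with []-bézout k m l p eq
    ...   | z , y , yz = y , z , trans (+-comm _ _) yz

    []-unit : ∀ m → suc m < p → Unit [ suc m ]
    []-unit m m<p with []-coprime (Coprimality.sym (prime⇒coprime p-prime m<p))
    ... | y , z , eq = unit-mod-nilpotent n [p]ⁿ≈0 y z eq

    -- From qᵖ + (1 - q)[p] = 1, as [p] is nilpotent.
    q^p-unit : Unit (q ^ p)
    q^p-unit = unit-mod-nilpotent n [p]ⁿ≈0 1# (1# - q) (begin
      q ^ p * 1# + [ p ] * (1# - q)       ≈⟨ solve 3 (λ x m q → x :* :1 :+ m :* (:1 :- q) := (x :+ m) :- q :* m) refl _ _ q ⟩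
      (q ^ p + [ p ]) - q * [ p ]         ≈⟨ +-congʳ (q^-[] p) ⟩
      (1# + q * [ p ]) - q * [ p ]        ≈⟨ solve 2 (λ m q → (:1 :+ q :* m) :- q :* m := :1) refl _ q ⟩
      1#                                  ∎)

-- The ring of polynomials over the rationals

-- Wrapping _≈ₚ_ makes the two polynomials inferable from the type.
infix 4 _≋_
record _≋_ (x y : Poly) : Set where
  constructor coeffwise
  field at : x ≈ₚ y
open _≋_ public

coeff-⊕ : ∀ x y i → coeff (x ⊕ y) i ≡ coeff x i ℚ.+ coeff y i
coeff-⊕ []       y        i       = ≡.sym (ℚₚ.+-identityˡ _)
coeff-⊕ (x ∷ xs) []       i       = ≡.sym (ℚₚ.+-identityʳ _)
coeff-⊕ (x ∷ xs) (y ∷ ys) zero    = ≡.refl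
coeff-⊕ (x ∷ xs) (y ∷ ys) (suc i) = coeff-⊕ xs ys i

coeff-neg : ∀ x i → coeff (neg x) i ≡ ℚ.- coeff x i
coeff-neg []       i       = ≡.refl
coeff-neg (x ∷ xs) zero    = ≡.refl
coeff-neg (x ∷ xs) (suc i) = coeff-neg xs i

scale : ℚ → Poly → Poly
scale c = map (c ℚ.*_)

coeff-scale : ∀ c x i → coeff (scale c x) i ≡ c ℚ.* coeff x i
coeff-scale c []       i       = ≡.sym (ℚₚ.*-zeroʳ c)
coeff-scale c (x ∷ xs) zero    = ≡.refl
coeff-scale c (x ∷ xs) (suc i) = coeff-scale c xs i

≋-isEquivalence : IsEquivalence _≋_
≋-isEquivalence = record
  { refl  = coeffwise λ i → ≡.refl
  ; sym   = λ p → coeffwise λ i → ≡.sym (at p i)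
  ; trans = λ p r → coeffwise λ i → ≡.trans (at p i) (at r i)
  }

Poly-setoid : Setoid 0ℓ 0ℓ
Poly-setoid = record { isEquivalence = ≋-isEquivalence }

module ≋ = Setoid Poly-setoid
module ≋-Reasoning where
  open import Relation.Binary.Reasoning.Setoid Poly-setoid public

⊕-cong : ∀ {x x′ y y′} → x ≋ x′ → y ≋ y′ → x ⊕ y ≋ x′ ⊕ y′
⊕-cong {x} {x′} {y} {y′} p r = coeffwise λ i →
  ≡.trans (coeff-⊕ x y i) (≡.trans (≡.cong₂ ℚ._+_ (at p i) (at r i)) (≡.sym (coeff-⊕ x′ y′ i)))

⊕-comm : ∀ x y → x ⊕ y ≋ y ⊕ x
⊕-comm x y = coeffwise λ i → ≡.trans (coeff-⊕ x y i) (≡.trans (ℚₚ.+-comm (coeff x i) (coeff y i)) (≡.sym (coeff-⊕ y x i)))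

⊕-assoc : ∀ x y z → (x ⊕ y) ⊕ z ≋ x ⊕ (y ⊕ z)
⊕-assoc x y z = coeffwise λ i → begin
  coeff ((x ⊕ y) ⊕ z) i                     ≡⟨ coeff-⊕ (x ⊕ y) z i ⟩
  coeff (x ⊕ y) i ℚ.+ coeff z i             ≡⟨ ≡.cong (ℚ._+ coeff z i) (coeff-⊕ x y i) ⟩
  coeff x i ℚ.+ coeff y i ℚ.+ coeff z i     ≡⟨ ℚₚ.+-assoc (coeff x i) (coeff y i) (coeff z i) ⟩
  coeff x i ℚ.+ (coeff y i ℚ.+ coeff z i)   ≡⟨ ≡.cong (coeff x i ℚ.+_) (coeff-⊕ y z i) ⟨
  coeff x i ℚ.+ coeff (y ⊕ z) i             ≡⟨ coeff-⊕ x (y ⊕ z) i ⟨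
  coeff (x ⊕ (y ⊕ z)) i                     ∎
  where open ≡.≡-Reasoning

⊕-identityʳ : ∀ x → x ⊕ [] ≋ x
⊕-identityʳ []       = ≋.refl
⊕-identityʳ (x ∷ xs) = ≋.refl

neg-cong : ∀ {x y} → x ≋ y → neg x ≋ neg y
neg-cong {x} {y} p = coeffwise λ i → ≡.trans (coeff-neg x i) (≡.trans (≡.cong ℚ.-_ (at p i)) (≡.sym (coeff-neg y i)))

⊕-inverseˡ : ∀ x → neg x ⊕ x ≋ []
⊕-inverseˡ x = coeffwise λ i →
  ≡.trans (coeff-⊕ (neg x) x i) (≡.trans (≡.cong (ℚ._+ coeff x i) (coeff-neg x i)) (ℚₚ.+-inverseˡ (coeff x i)))

⊕-interchange : ∀ w x y z → (w ⊕ x) ⊕ (y ⊕ z) ≋ (w ⊕ y) ⊕ (x ⊕ z)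
⊕-interchange w x y z = coeffwise λ i → ≡.trans (expand w x y z i)
  (≡.trans (interchange (coeff w i) (coeff x i) (coeff y i) (coeff z i)) (≡.sym (expand w y x z i)))
  where
  open import Algebra.Properties.CommutativeSemigroup (CommutativeRing.+-commutativeSemigroup ℚₚ.+-*-commutativeRing) using (interchange)
  expand : ∀ w x y z i → coeff ((w ⊕ x) ⊕ (y ⊕ z)) i ≡ (coeff w i ℚ.+ coeff x i) ℚ.+ (coeff y i ℚ.+ coeff z i)
  expand w x y z i = ≡.trans (coeff-⊕ (w ⊕ x) (y ⊕ z) i) (≡.cong₂ ℚ._+_ (coeff-⊕ w x i) (coeff-⊕ y z i))

∷-cong : ∀ {a b x y} → a ≡ b → x ≋ y → a ∷ x ≋ b ∷ y
∷-cong p r = coeffwise λ { zero → p ; (suc i) → at r i }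

0∷[]≋[] : 0ℚ ∷ [] ≋ []
0∷[]≋[] = coeffwise λ { zero → ≡.refl ; (suc i) → ≡.refl }

scale-cong : ∀ {a b x y} → a ≡ b → x ≋ y → scale a x ≋ scale b y
scale-cong {a} {b} {x} {y} p r = coeffwise λ i →
  ≡.trans (coeff-scale a x i) (≡.trans (≡.cong₂ ℚ._*_ p (at r i)) (≡.sym (coeff-scale b y i)))

scale-⊕ : ∀ a x y → scale a (x ⊕ y) ≋ scale a x ⊕ scale a y
scale-⊕ a x y = coeffwise λ i → begin
  coeff (scale a (x ⊕ y)) i                       ≡⟨ coeff-scale a (x ⊕ y) i ⟩
  a ℚ.* coeff (x ⊕ y) i                           ≡⟨ ≡.cong (a ℚ.*_) (coeff-⊕ x y i) ⟩
  a ℚ.* (coeff x i ℚ.+ coeff y i)                 ≡⟨ ℚₚ.*-distribˡ-+ a _ _ ⟩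
  a ℚ.* coeff x i ℚ.+ a ℚ.* coeff y i             ≡⟨ ≡.cong₂ ℚ._+_ (coeff-scale a x i) (coeff-scale a y i) ⟨
  coeff (scale a x) i ℚ.+ coeff (scale a y) i     ≡⟨ coeff-⊕ (scale a x) (scale a y) i ⟨
  coeff (scale a x ⊕ scale a y) i                 ∎
  where open ≡.≡-Reasoning

scale-scale : ∀ a b x → scale (a ℚ.* b) x ≋ scale a (scale b x)
scale-scale a b x = coeffwise λ i → begin
  coeff (scale (a ℚ.* b) x) i     ≡⟨ coeff-scale (a ℚ.* b) x i ⟩
  a ℚ.* b ℚ.* coeff x i           ≡⟨ ℚₚ.*-assoc a b (coeff x i) ⟩
  a ℚ.* (b ℚ.* coeff x i)         ≡⟨ ≡.cong (a ℚ.*_) (coeff-scale b x i) ⟨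
  a ℚ.* coeff (scale b x) i       ≡⟨ coeff-scale a (scale b x) i ⟨
  coeff (scale a (scale b x)) i   ∎
  where open ≡.≡-Reasoning

scale-1 : ∀ x → scale 1ℚ x ≋ x
scale-1 x = coeffwise λ i → ≡.trans (coeff-scale 1ℚ x i) (ℚₚ.*-identityˡ _)

scale-0 : ∀ x → scale 0ℚ x ≋ []
scale-0 x = coeffwise λ i → ≡.trans (coeff-scale 0ℚ x i) (ℚₚ.*-zeroˡ (coeff x i))

⊗-congˡ : ∀ x {y z} → y ≋ z → x ⊗ y ≋ x ⊗ z
⊗-congˡ []       p = ≋.refl
⊗-congˡ (a ∷ x) p = ⊕-cong (scale-cong {a} ≡.refl p) (∷-cong ≡.refl (⊗-congˡ x p))

⊗-zeroʳ : ∀ x → x ⊗ [] ≋ []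
⊗-zeroʳ []      = ≋.refl
⊗-zeroʳ (a ∷ x) = ≋.trans (∷-cong ≡.refl (⊗-zeroʳ x)) 0∷[]≋[]

-- The mirror image of the defining clause of `_⊗_`, from which commutativity follows by induction.
⊗-∷ʳ : ∀ x b y → x ⊗ (b ∷ y) ≋ scale b x ⊕ (0ℚ ∷ (x ⊗ y))
⊗-∷ʳ []      b y = ≋.sym 0∷[]≋[]
⊗-∷ʳ (a ∷ x) b y = ∷-cong (≡.cong (ℚ._+ 0ℚ) (ℚₚ.*-comm a b)) (begin
  scale a y ⊕ (x ⊗ (b ∷ y))                       ≈⟨ ⊕-cong ≋.refl (⊗-∷ʳ x b y) ⟩
  scale a y ⊕ (scale b x ⊕ (0ℚ ∷ (x ⊗ y)))        ≈⟨ ⊕-assoc (scale a y) (scale b x) _ ⟨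
  (scale a y ⊕ scale b x) ⊕ (0ℚ ∷ (x ⊗ y))        ≈⟨ ⊕-cong (⊕-comm (scale a y) (scale b x)) ≋.refl ⟩
  (scale b x ⊕ scale a y) ⊕ (0ℚ ∷ (x ⊗ y))        ≈⟨ ⊕-assoc (scale b x) (scale a y) _ ⟩
  scale b x ⊕ (scale a y ⊕ (0ℚ ∷ (x ⊗ y)))        ∎)
  where open ≋-Reasoning

⊗-comm : ∀ x y → x ⊗ y ≋ y ⊗ x
⊗-comm []      y = ≋.sym (⊗-zeroʳ y)
⊗-comm (a ∷ x) y = ≋.trans (⊕-cong ≋.refl (∷-cong ≡.refl (⊗-comm x y))) (≋.sym (⊗-∷ʳ y a x))

-- Equal polynomials may be lists of different lengths, so instead of a recursion on both lists,
-- commutativity moves them to the other factor.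
⊗-congʳ : ∀ {x y} z → x ≋ y → x ⊗ z ≋ y ⊗ z
⊗-congʳ {x} {y} z p = ≋.trans (⊗-comm x z) (≋.trans (⊗-congˡ z p) (⊗-comm z y))

⊗-cong : ∀ {x x′ y y′} → x ≋ x′ → y ≋ y′ → x ⊗ y ≋ x′ ⊗ y′
⊗-cong {x′ = x′} {y = y} p r = ≋.trans (⊗-congʳ y p) (⊗-congˡ x′ r)

⊗-distribˡ-⊕ : ∀ x y z → x ⊗ (y ⊕ z) ≋ (x ⊗ y) ⊕ (x ⊗ z)
⊗-distribˡ-⊕ []      y z = ≋.refl
⊗-distribˡ-⊕ (a ∷ x) y z = begin
  scale a (y ⊕ z) ⊕ (0ℚ ∷ (x ⊗ (y ⊕ z)))                                   ≈⟨ ⊕-cong (scale-⊕ a y z) (∷-cong ≡.refl (⊗-distribˡ-⊕ x y z)) ⟩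
  (scale a y ⊕ scale a z) ⊕ ((0ℚ ∷ (x ⊗ y)) ⊕ (0ℚ ∷ (x ⊗ z)))              ≈⟨ ⊕-interchange (scale a y) (scale a z) _ _ ⟩
  (scale a y ⊕ (0ℚ ∷ (x ⊗ y))) ⊕ (scale a z ⊕ (0ℚ ∷ (x ⊗ z)))              ∎
  where open ≋-Reasoning

⊗-distribʳ-⊕ : ∀ x y z → (y ⊕ z) ⊗ x ≋ (y ⊗ x) ⊕ (z ⊗ x)
⊗-distribʳ-⊕ x y z = ≋.trans (⊗-comm (y ⊕ z) x) (≋.trans (⊗-distribˡ-⊕ x y z) (⊕-cong (⊗-comm x y) (⊗-comm x z)))

0∷-⊗ : ∀ x y → (0ℚ ∷ x) ⊗ y ≋ 0ℚ ∷ (x ⊗ y)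
0∷-⊗ x y = ⊕-cong (scale-0 y) ≋.refl

scale-⊗ : ∀ a x y → scale a x ⊗ y ≋ scale a (x ⊗ y)
scale-⊗ a []      y = ≋.refl
scale-⊗ a (b ∷ x) y = begin
  scale (a ℚ.* b) y ⊕ (0ℚ ∷ (scale a x ⊗ y))            ≈⟨ ⊕-cong (scale-scale a b y) (∷-cong (≡.sym (ℚₚ.*-zeroʳ a)) (scale-⊗ a x y)) ⟩
  scale a (scale b y) ⊕ scale a (0ℚ ∷ (x ⊗ y))          ≈⟨ scale-⊕ a (scale b y) _ ⟨
  scale a (scale b y ⊕ (0ℚ ∷ (x ⊗ y)))                  ∎
  where open ≋-Reasoning

⊗-assoc : ∀ x y z → (x ⊗ y) ⊗ z ≋ x ⊗ (y ⊗ z)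
⊗-assoc []      y z = ≋.refl
⊗-assoc (a ∷ x) y z = begin
  (scale a y ⊕ (0ℚ ∷ (x ⊗ y))) ⊗ z              ≈⟨ ⊗-distribʳ-⊕ z (scale a y) _ ⟩
  (scale a y ⊗ z) ⊕ ((0ℚ ∷ (x ⊗ y)) ⊗ z)        ≈⟨ ⊕-cong (scale-⊗ a y z) (0∷-⊗ (x ⊗ y) z) ⟩
  scale a (y ⊗ z) ⊕ (0ℚ ∷ ((x ⊗ y) ⊗ z))        ≈⟨ ⊕-cong ≋.refl (∷-cong ≡.refl (⊗-assoc x y z)) ⟩
  scale a (y ⊗ z) ⊕ (0ℚ ∷ (x ⊗ (y ⊗ z)))        ∎
  where open ≋-Reasoning

⊗-identityˡ : ∀ x → one ⊗ x ≋ x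
⊗-identityˡ x = ≋.trans (⊕-cong (scale-1 x) 0∷[]≋[]) (⊕-identityʳ x)

ℚ[q] : CommutativeRing 0ℓ 0ℓ
ℚ[q] = record
  { Carrier = Poly
  ; _≈_ = _≋_
  ; _+_ = _⊕_
  ; _*_ = _⊗_
  ; -_ = neg
  ; 0# = []
  ; 1# = one
  ; isCommutativeRing = record
    { isRing = record
      { +-isAbelianGroup = record
        { isGroup = record
          { isMonoid = record
            { isSemigroup = record
              { isMagma = record { isEquivalence = ≋-isEquivalence ; ∙-cong = ⊕-cong }
              ; assoc = ⊕-assoc
              }
            ; identity = (λ x → ≋.refl) , ⊕-identityʳ
            }
          ; inverse = ⊕-inverseˡ , λ x → ≋.trans (⊕-comm x (neg x)) (⊕-inverseˡ x)
          ; ⁻¹-cong = neg-cong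
          }
        ; comm = ⊕-comm
        }
      ; *-cong = ⊗-cong
      ; *-assoc = ⊗-assoc
      ; *-identity = ⊗-identityˡ , λ x → ≋.trans (⊗-comm x one) (⊗-identityˡ x)
      ; distrib = ⊗-distribˡ-⊕ , ⊗-distribʳ-⊕
      }
    ; *-comm = ⊗-comm
    }
  }

-- Polynomials with integer coefficients

fromℤ : ℤ → ℚ
fromℤ z = mkℚ z 0 (Coprimality.sym (1-coprimeTo ℤ.∣ z ∣))

Integer : ℚ → Set
Integer x = ∃[ z ] x ≡ fromℤ z

fromℤ-+ : ∀ y z → fromℤ y ℚ.+ fromℤ z ≡ fromℤ (y ℤ.+ z)
fromℤ-+ y z = ℚₚ.toℚᵘ-injective (ℚᵘₚ.≃-trans (ℚₚ.toℚᵘ-homo-+ (fromℤ y) (fromℤ z))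
  (ℚᵘ.*≡* (≡.cong (ℤ._* + 1) (≡.cong₂ ℤ._+_ (ℤₚ.*-identityʳ y) (ℤₚ.*-identityʳ z)))))

fromℤ-* : ∀ y z → fromℤ y ℚ.* fromℤ z ≡ fromℤ (y ℤ.* z)
fromℤ-* y z = ℚₚ.toℚᵘ-injective (ℚᵘₚ.≃-trans (ℚₚ.toℚᵘ-homo-* (fromℤ y) (fromℤ z)) (ℚᵘ.*≡* ≡.refl))

fromℤ-neg : ∀ z → ℚ.- fromℤ z ≡ fromℤ (ℤ.- z)
fromℤ-neg z = ℚₚ.toℚᵘ-injective (ℚᵘₚ.≃-trans (ℚₚ.toℚᵘ-homo‿- (fromℤ z)) (ℚᵘ.*≡* ≡.refl))

integer-0 : Integer 0ℚ
integer-0 = + 0 , ≡.refl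

integer-1 : Integer 1ℚ
integer-1 = + 1 , ≡.refl

integer-+ : ∀ {x y} → Integer x → Integer y → Integer (x ℚ.+ y)
integer-+ (y , ≡.refl) (z , ≡.refl) = y ℤ.+ z , fromℤ-+ y z

integer-* : ∀ {x y} → Integer x → Integer y → Integer (x ℚ.* y)
integer-* (y , ≡.refl) (z , ≡.refl) = y ℤ.* z , fromℤ-* y z

integer-neg : ∀ {x} → Integer x → Integer (ℚ.- x)
integer-neg (z , ≡.refl) = ℤ.- z , fromℤ-neg z

-- Integers lie in ℤ₍ₚ₎ for every p, so a cofactor found over the integers is admissible at each
-- prime.
Integral : Poly → Set
Integral = All Integer

integral-one : Integral one
integral-one = integer-1 ∷ []

integral-⊕ : ∀ {x y} → Integral x → Integral y → Integral (x ⊕ y)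
integral-⊕ []            y-int         = y-int
integral-⊕ (a ∷ x-int)   []            = a ∷ x-int
integral-⊕ (a ∷ x-int)   (b ∷ y-int)   = integer-+ a b ∷ integral-⊕ x-int y-int

integral-neg : ∀ {x} → Integral x → Integral (neg x)
integral-neg = map⁺ ∘ All.map integer-neg

integral-⊗ : ∀ {x y} → Integral x → Integral y → Integral (x ⊗ y)
integral-⊗ []          y-int = []
integral-⊗ (a ∷ x-int) y-int = integral-⊕ (map⁺ (All.map (integer-* a) y-int)) (integer-0 ∷ integral-⊗ x-int y-int)

integral-coeff : ∀ {x} → Integral x → ∀ i → Integer (coeff x i)
integral-coeff []          i       = integer-0
integral-coeff (a ∷ x-int) zero    = a
integral-coeff (a ∷ x-int) (suc i) = integral-coeff x-int i

integer⇒InZp : ∀ {p x} → Prime p → Integer x → InZp p x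
integer⇒InZp p-prime (z , ≡.refl) p∣1 = ¬prime[1] (≡.subst Prime (∣1⇒≡1 p∣1) p-prime)

-- The quotient of a subring by a principal ideal

record IsSubring {c ℓ s} (K : CommutativeRing c ℓ) (S : CommutativeRing.Carrier K → Set s) : Set (c ⊔ s) where
  open CommutativeRing K
  field
    S-0   : S 0#
    S-1   : S 1#
    S-neg : ∀ {x} → S x → S (- x)
    S-+   : ∀ {x y} → S x → S y → S (x + y)
    S-*   : ∀ {x y} → S x → S y → S (x * y)

module SubringQuotient {c ℓ s} (K : CommutativeRing c ℓ) (S : CommutativeRing.Carrier K → Set s) (S-subring : IsSubring K S)
  (M : CommutativeRing.Carrier K) (S-M : S M) where

  open CommutativeRing K
  open IsSubring S-subring
  open RingSolver K

  infix 4 _≈ᴹ_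
  -- The cofactor must lie in the subring: the ideal is M S and not M K, which could be larger. The
  -- integrality demanded of the cofactor in `EqIn` comes from here.
  record _≈ᴹ_ (x y : Σ Carrier S) : Set (c ⊔ ℓ ⊔ s) where
    constructor congruent
    field
      factor   : Carrier
      S-factor : S factor
      equation : proj₁ x ≈ proj₁ y + factor * M

  embed : ∀ {x y : Σ Carrier S} → proj₁ x ≈ proj₁ y → x ≈ᴹ y
  embed eq = congruent 0# S-0 (trans eq (solve 2 (λ y m → y := y :+ con (0 , 0) :* m) refl _ M))

  quotient : CommutativeRing (c ⊔ s) (c ⊔ ℓ ⊔ s)
  quotient = record
    { Carrier = Σ Carrier S
    ; _≈_ = _≈ᴹ_
    ; _+_ = λ (x , Sx) (y , Sy) → x + y , S-+ Sx Sy
    ; _*_ = λ (x , Sx) (y , Sy) → x * y , S-* Sx Sy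
    ; -_ = λ (x , Sx) → - x , S-neg Sx
    ; 0# = 0# , S-0
    ; 1# = 1# , S-1
    ; isCommutativeRing = record
      { isRing = record
        { +-isAbelianGroup = record
          { isGroup = record
            { isMonoid = record
              { isSemigroup = record
                { isMagma = record
                  { isEquivalence = record
                    { refl  = embed refl
                    ; sym   = λ { {x} {y} (congruent d Sd eq) → congruent (- d) (S-neg Sd)
                        (trans (solve 3 (λ y d m → y := (y :+ d :* m) :+ (:- d) :* m) refl _ d M) (+-congʳ (sym eq))) }
                    ; trans = λ { (congruent d Sd eq) (congruent e Se eq′) → congruent (e + d) (S-+ Se Sd)
                        (trans eq (trans (+-congʳ eq′) (solve 4 (λ y d e m → (y :+ e :* m) :+ d :* m := y :+ (e :+ d) :* m) refl _ d e M))) }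
                    }
                  ; ∙-cong = λ { (congruent d Sd eq) (congruent e Se eq′) → congruent (d + e) (S-+ Sd Se)
                      (trans (+-cong eq eq′) (solve 5 (λ x y d e m → (x :+ d :* m) :+ (y :+ e :* m) := (x :+ y) :+ (d :+ e) :* m) refl _ _ d e M)) }
                  }
                ; assoc = λ x y z → embed (+-assoc _ _ _)
                }
              ; identity = (λ x → embed (+-identityˡ _)) , (λ x → embed (+-identityʳ _))
              }
            ; inverse = (λ x → embed (-‿inverseˡ _)) , (λ x → embed (-‿inverseʳ _))
            ; ⁻¹-cong = λ { (congruent d Sd eq) → congruent (- d) (S-neg Sd)
                (trans (-‿cong eq) (solve 3 (λ y d m → :- (y :+ d :* m) := (:- y) :+ (:- d) :* m) refl _ d M)) }
            }
          ; comm = λ x y → embed (+-comm _ _)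
          }
        ; *-cong = λ { {_} {x , Sx} {_} {y , Sy} (congruent d Sd eq) (congruent e Se eq′) →
            congruent (x * e + d * y + d * e * M) (S-+ (S-+ (S-* Sx Se) (S-* Sd Sy)) (S-* (S-* Sd Se) S-M))
              (trans (*-cong eq eq′) (solve 5 (λ x y d e m → (x :+ d :* m) :* (y :+ e :* m) := x :* y :+ (x :* e :+ d :* y :+ d :* e :* m) :* m) refl x y d e M)) }
        ; *-assoc = λ x y z → embed (*-assoc _ _ _)
        ; *-identity = (λ x → embed (*-identityˡ _)) , (λ x → embed (*-identityʳ _))
        ; distrib = (λ x y z → embed (distribˡ _ _ _)) , (λ x y z → embed (distribʳ _ _ _))
        }
      ; *-comm = λ x y → embed (*-comm _ _)
      }
    }

-- Reduction of integral polynomials modulo [p]ⁿ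

integral-qpow : ∀ m → Integral (qpow m)
integral-qpow zero    = integral-one
integral-qpow (suc m) = integer-0 ∷ integral-qpow m

integral-qint : ∀ m → Integral (qint m)
integral-qint zero    = []
integral-qint (suc m) = integral-⊕ (integral-qint m) (integral-qpow m)

integral-^ₚ : ∀ {x} e → Integral x → Integral (x ^ₚ e)
integral-^ₚ zero    x-int = integral-one
integral-^ₚ (suc e) x-int = integral-⊗ x-int (integral-^ₚ e x-int)

integral-isSubring : IsSubring ℚ[q] Integral
integral-isSubring = record { S-0 = [] ; S-1 = integral-one ; S-neg = integral-neg ; S-+ = integral-⊕ ; S-* = integral-⊗ }

-- The properties of the projection used later: a ring homomorphism that kills [p]ⁿ and whose kernel
-- consists of integral multiples of [p]ⁿ. By `⟦⟧-≋` its value does not depend on the proof of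
-- integrality.
record Reduction (p n : ℕ) {c ℓ} (R : CommutativeRing c ℓ) : Set (c ⊔ ℓ) where
  open CommutativeRing R
  field
    ⟦_⟧    : ∀ {x} → Integral x → Carrier
    ⟦⟧-≋   : ∀ {x y} (x-int : Integral x) (y-int : Integral y) → x ≋ y → ⟦ x-int ⟧ ≈ ⟦ y-int ⟧
    ⟦⟧-0   : ⟦ [] ⟧ ≈ 0#
    ⟦⟧-1   : ⟦ integral-one ⟧ ≈ 1#
    ⟦⟧-⊕   : ∀ {x y} (x-int : Integral x) (y-int : Integral y) → ⟦ integral-⊕ x-int y-int ⟧ ≈ ⟦ x-int ⟧ + ⟦ y-int ⟧
    ⟦⟧-⊗   : ∀ {x y} (x-int : Integral x) (y-int : Integral y) → ⟦ integral-⊗ x-int y-int ⟧ ≈ ⟦ x-int ⟧ * ⟦ y-int ⟧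
    kernel : ∀ {x} (x-int : Integral x) → ⟦ x-int ⟧ ≈ 0# → ∃[ c ] (Integral c × x ≋ c ⊗ (qint p ^ₚ n))
    ⟦M⟧    : ⟦ integral-^ₚ n (integral-qint p) ⟧ ≈ 0#

module _ (p n : ℕ) where
  private
    module Quotient = SubringQuotient ℚ[q] Integral integral-isSubring (qint p ^ₚ n) (integral-^ₚ n (integral-qint p))
  open Quotient using (congruent; embed)

  ℤ[q]/[p]ⁿ : CommutativeRing 0ℓ 0ℓ
  ℤ[q]/[p]ⁿ = Quotient.quotient

  reduction : Reduction p n ℤ[q]/[p]ⁿ
  reduction = record
    { ⟦_⟧    = λ {x} x-int → x , x-int
    ; ⟦⟧-≋   = λ _ _ → embed
    ; ⟦⟧-0   = embed ≋.refl
    ; ⟦⟧-1   = embed ≋.refl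
    ; ⟦⟧-⊕   = λ _ _ → embed ≋.refl
    ; ⟦⟧-⊗   = λ _ _ → embed ≋.refl
    ; kernel = λ { _ (congruent c c-int eq) → c , c-int , eq }
    ; ⟦M⟧    = congruent one integral-one (≋.sym (⊗-identityˡ (qint p ^ₚ n)))
    }

-- Fractions and their values in the quotient

module Residues {p n : ℕ} {c ℓ} {R : CommutativeRing c ℓ} (reduction : Reduction p n R) where
  open CommutativeRing R
  open Reduction reduction
  open RingSolver R
  open StarSums R
  open import Relation.Binary.Reasoning.Setoid setoid

  q : Carrier
  q = ⟦ integral-qpow 1 ⟧

  open QTables R q

  ⟦qpow⟧ : ∀ m → ⟦ integral-qpow m ⟧ ≈ q ^ m
  ⟦qpow⟧ zero    = ⟦⟧-1
  ⟦qpow⟧ (suc m) = begin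
    ⟦ integral-qpow (suc m) ⟧                       ≈⟨ ⟦⟧-≋ _ _ (≋.trans (0∷-⊗ one (qpow m)) (∷-cong ≡.refl (⊗-identityˡ (qpow m)))) ⟨
    ⟦ integral-⊗ (integral-qpow 1) (integral-qpow m) ⟧ ≈⟨ ⟦⟧-⊗ _ _ ⟩
    q * ⟦ integral-qpow m ⟧                         ≈⟨ *-congˡ (⟦qpow⟧ m) ⟩
    q ^ suc m                                       ∎

  ⟦qint⟧ : ∀ m → ⟦ integral-qint m ⟧ ≈ [ m ]
  ⟦qint⟧ zero    = ⟦⟧-0
  ⟦qint⟧ (suc m) = trans (⟦⟧-⊕ _ _) (+-cong (⟦qint⟧ m) (⟦qpow⟧ m))

  ⟦^ₚ⟧ : ∀ {x r} (x-int : Integral x) e → ⟦ x-int ⟧ ≈ r → ⟦ integral-^ₚ e x-int ⟧ ≈ r ^ e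
  ⟦^ₚ⟧ x-int zero    eq = ⟦⟧-1
  ⟦^ₚ⟧ x-int (suc e) eq = trans (⟦⟧-⊗ _ _) (*-cong eq (⟦^ₚ⟧ x-int e eq))

  [p]ⁿ≈0 : [ p ] ^ n ≈ 0#
  [p]ⁿ≈0 = trans (sym (⟦^ₚ⟧ (integral-qint p) n (⟦qint⟧ p))) ⟦M⟧

  infix 4 _represents_
  -- The inverse of the denominator is part of the data, so sums and products of fractions have
  -- values without any further unit argument.
  record _represents_ (f : Frac) (r : Carrier) : Set (c ⊔ ℓ) where
    field
      num-int : Integral (num f)
      den-int : Integral (den f)
      den⁻¹   : Carrier
      den-inv : ⟦ den-int ⟧ * den⁻¹ ≈ 1#
      value   : ⟦ num-int ⟧ * den⁻¹ ≈ r
  open _represents_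

  rep-≈ : ∀ {f r s} → f represents r → r ≈ s → f represents s
  rep-≈ F r≈s = record { num-int = num-int F ; den-int = den-int F ; den⁻¹ = den⁻¹ F ; den-inv = den-inv F ; value = trans (value F) r≈s }

  rep-quotient : ∀ {x y r s} (x-int : Integral x) (y-int : Integral y) → ⟦ x-int ⟧ ≈ r → ⟦ y-int ⟧ * s ≈ 1# → (x /ₚ y) represents r * s
  rep-quotient x-int y-int x≈r ys≈1 = record { num-int = x-int ; den-int = y-int ; den⁻¹ = _ ; den-inv = ys≈1 ; value = *-congʳ x≈r }

  rep-poly : ∀ {x r} (x-int : Integral x) → ⟦ x-int ⟧ ≈ r → poly x represents r
  rep-poly x-int x≈r = rep-≈ (rep-quotient x-int integral-one x≈r (trans (*-identityʳ _) ⟦⟧-1)) (*-identityʳ _)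

  private
    den-inv₂ : ∀ {f g r s} (F : f represents r) (G : g represents s) →
               ⟦ integral-⊗ (den-int F) (den-int G) ⟧ * (den⁻¹ F * den⁻¹ G) ≈ 1#
    den-inv₂ F G = begin
      ⟦ integral-⊗ (den-int F) (den-int G) ⟧ * (den⁻¹ F * den⁻¹ G)            ≈⟨ *-congʳ (⟦⟧-⊗ _ _) ⟩
      (⟦ den-int F ⟧ * ⟦ den-int G ⟧) * (den⁻¹ F * den⁻¹ G)                  ≈⟨ solve 4 (λ a b c d → (a :* b) :* (c :* d) := (a :* c) :* (b :* d)) refl _ _ _ _ ⟩
      (⟦ den-int F ⟧ * den⁻¹ F) * (⟦ den-int G ⟧ * den⁻¹ G)                  ≈⟨ *-cong (den-inv F) (den-inv G) ⟩
      1# * 1#                                                               ≈⟨ *-identityˡ 1# ⟩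
      1#                                                                    ∎

  rep-* : ∀ {f g r s} → f represents r → g represents s → f *F g represents r * s
  rep-* {f} {g} F G = record
    { num-int = integral-⊗ (num-int F) (num-int G)
    ; den-int = integral-⊗ (den-int F) (den-int G)
    ; den⁻¹   = den⁻¹ F * den⁻¹ G
    ; den-inv = den-inv₂ F G
    ; value   = trans (*-congʳ (⟦⟧-⊗ _ _)) (trans (solve 4 (λ a b c d → (a :* b) :* (c :* d) := (a :* c) :* (b :* d)) refl _ _ _ _)
                      (*-cong (value F) (value G)))
    }

  rep-+ : ∀ {f g r s} → f represents r → g represents s → f +F g represents r + s
  rep-+ {f} {g} {r} {s} F G = record
    { num-int = integral-⊕ (integral-⊗ (num-int F) (den-int G)) (integral-⊗ (num-int G) (den-int F))
    ; den-int = integral-⊗ (den-int F) (den-int G)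
    ; den⁻¹   = den⁻¹ F * den⁻¹ G
    ; den-inv = den-inv₂ F G
    ; value   = begin
        ⟦ integral-⊕ (integral-⊗ (num-int F) (den-int G)) (integral-⊗ (num-int G) (den-int F)) ⟧ * (u * v)
                                                 ≈⟨ *-congʳ (trans (⟦⟧-⊕ _ _) (+-cong (⟦⟧-⊗ _ _) (⟦⟧-⊗ _ _))) ⟩
        (a * t + b * d) * (u * v)                ≈⟨ solve 6 (λ a b d t u v → (a :* t :+ b :* d) :* (u :* v) := (a :* u) :* (t :* v) :+ (b :* v) :* (d :* u)) refl a b d t u v ⟩
        (a * u) * (t * v) + (b * v) * (d * u)    ≈⟨ +-cong (*-cong (value F) (den-inv G)) (*-cong (value G) (den-inv F)) ⟩
        r * 1# + s * 1#                          ≈⟨ +-cong (*-identityʳ r) (*-identityʳ s) ⟩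
        r + s                                    ∎
    }
    where
    a = ⟦ num-int F ⟧
    b = ⟦ num-int G ⟧
    d = ⟦ den-int F ⟧
    t = ⟦ den-int G ⟧
    u = den⁻¹ F
    v = den⁻¹ G

  rep-1 : 1F represents 1#
  rep-1 = rep-poly integral-one ⟦⟧-1

  rep-^ : ∀ {f r} e → f represents r → f ^F e represents r ^ e
  rep-^ zero    F = rep-1
  rep-^ (suc e) F = rep-* F (rep-^ e F)

  rep-sumTo : ∀ {f g} M → (∀ m → m < M → f (suc m) represents g (suc m)) → sumTo M f represents sum₁ M g
  rep-sumTo zero    F = rep-poly [] ⟦⟧-0
  rep-sumTo (suc M) F = rep-+ (rep-sumTo M (λ m m<M → F m (ℕₚ.<-trans m<M (ℕₚ.n<1+n M)))) (F M (ℕₚ.n<1+n M))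

  rep-sumBelow : ∀ {f g} L → (∀ l → f l represents g l) → sumBelow L f represents sum₀ L g
  rep-sumBelow zero    F = rep-poly [] ⟦⟧-0
  rep-sumBelow (suc L) F = rep-+ (rep-sumBelow L F) (F L)

  -- A unit denominator forces the numerator itself to be 0 in R, and the kernel property then
  -- yields the cofactor of [p]ⁿ.
  represents-0⇒EqIn : Prime p → ∀ {f} → f represents 0# → EqIn p n f 0F
  represents-0⇒EqIn p-prime {f} F with kernel (num-int F) num≈0
    where
    num≈0 : ⟦ num-int F ⟧ ≈ 0#
    num≈0 = begin
      a             ≈⟨ *-identityʳ a ⟨
      a * 1#        ≈⟨ *-congˡ (den-inv F) ⟨
      a * (d * u)   ≈⟨ solve 3 (λ a d u → a :* (d :* u) := d :* (a :* u)) refl a d u ⟩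
      d * (a * u)   ≈⟨ *-congˡ (value F) ⟩
      d * 0#        ≈⟨ zeroʳ d ⟩
      0#            ∎
      where
      a = ⟦ num-int F ⟧
      d = ⟦ den-int F ⟧
      u = den⁻¹ F
  ... | c , c-int , eq = c , (λ i → integer⇒InZp p-prime (integral-coeff c-int i)) ,
    at (≋.trans (≋.trans (⊕-identityʳ _) (CommutativeRing.*-identityʳ ℚ[q] (num f))) eq)

-- Evaluating the sums at an odd prime

odd-prime : ∀ {N} → Prime (suc N) → 2 < suc N → ∃[ j ] N ≡ j ℕ.* 2
odd-prime {N} p-prime 2<p with suc N % 2 in rem | m%n<n (suc N) 2 | m≡m%n+[m/n]*n (suc N) 2
... | 0 | _ | _ with prime⇒irreducible p-prime (m%n≡0⇒n∣m (suc N) 2 rem)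
...   | inj₂ 2≡p = contradiction 2<p (ℕₚ.<-irrefl 2≡p)
odd-prime {N} p-prime 2<p | 1 | _ | eq = suc N ℕ./ 2 , ℕₚ.suc-injective eq
odd-prime {N} p-prime 2<p | suc (suc _) | s≤s (s≤s ()) | _

module Evaluation {N n : ℕ} (p-prime : Prime (suc N)) {c ℓ} {R : CommutativeRing c ℓ} (reduction : Reduction (suc N) n R) where
  open CommutativeRing R
  open Reduction reduction
  open Residues reduction
  open StarSums R
  open Units R
  open QTables R q
  open QUnits q (suc N) n p-prime [p]ⁿ≈0
  open import Algebra.Properties.CommutativeSemiring.Exp commutativeSemiring using (^-distrib-*; ^-congˡ)
  open import Relation.Binary.Reasoning.Setoid setoid

  -- The value 0 is a filler outside 1, ..., N, where `i-inv` claims nothing.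
  i : ℕ → Carrier
  i zero    = 0#
  i (suc m) with m ℕ.<? N
  ... | yes m<N = proj₁ ([]-unit m (s≤s m<N))
  ... | no  _   = 0#

  i-inv : ∀ m → m < N → [ suc m ] * i (suc m) ≈ 1#
  i-inv m m<N with m ℕ.<? N
  ... | yes m<N′ = proj₂ ([]-unit m (s≤s m<N′))
  ... | no  m≮N  = contradiction m<N m≮N

  open Duality R q N i i-inv

  q-unit : Unit q
  q-unit = unit-factor q^p-unit

  q⁻¹ : Carrier
  q⁻¹ = proj₁ q-unit

  rep-qpow : ∀ m → poly (qpow m) represents q ^ m
  rep-qpow m = rep-poly (integral-qpow m) (⟦qpow⟧ m)

  rep-qint : poly (qint (suc N)) represents [ suc N ]
  rep-qint = rep-poly (integral-qint (suc N)) (⟦qint⟧ (suc N))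

  rep-quantum : ∀ e k m → m < N → (qpow e /ₚ (qint (suc m) ^ₚ k)) represents q ^ e * i (suc m) ^ k
  rep-quantum e k m m<N = rep-quotient (integral-qpow e) (integral-^ₚ k (integral-qint (suc m))) (⟦qpow⟧ e) (begin
    ⟦ integral-^ₚ k (integral-qint (suc m)) ⟧ * i (suc m) ^ k   ≈⟨ *-congʳ (⟦^ₚ⟧ (integral-qint (suc m)) k (⟦qint⟧ (suc m))) ⟩
    [ suc m ] ^ k * i (suc m) ^ k                               ≈⟨ ^-distrib-* [ suc m ] (i (suc m)) k ⟨
    ([ suc m ] * i (suc m)) ^ k                                 ≈⟨ ^-congˡ k (i-inv m m<N) ⟩
    1# ^ k                                                      ≈⟨ 1^ k ⟩
    1#                                                          ∎)
    where
    1^ : ∀ k → 1# ^ k ≈ 1#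
    1^ zero    = refl
    1^ (suc k) = trans (*-identityˡ _) (1^ k)

  rep-Hstar : ∀ ks {M} → M ≤ N → Hstar M ks represents star w M ks
  rep-Hstar []       M≤N = rep-1
  rep-Hstar (k ∷ ks) M≤N = rep-sumTo _ λ m m<M →
    rep-* (rep-quantum ((k ℕ.∸ 1) ℕ.* suc m) k m (ℕₚ.<-≤-trans m<M M≤N)) (rep-Hstar ks (ℕₚ.<-≤-trans m<M M≤N))

  rep-HbarStar : ∀ ks {M} → M ≤ N → HbarStar M ks represents star w̄ M ks
  rep-HbarStar []       M≤N = rep-1
  rep-HbarStar (k ∷ ks) M≤N = rep-sumTo _ λ m m<M →
    rep-* (rep-quantum (suc m) k m (ℕₚ.<-≤-trans m<M M≤N)) (rep-HbarStar ks (ℕₚ.<-≤-trans m<M M≤N))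

  rep-qinvp : qinvp (suc N) represents q⁻¹ ^ suc N
  rep-qinvp = rep-≈ (rep-quotient integral-one (integral-qpow (suc N)) ⟦⟧-1
    (trans (*-congʳ (⟦qpow⟧ (suc N))) (Invertible.q^-inv q⁻¹ (proj₂ q-unit) (suc N)))) (*-identityˡ _)

  -- With p = N + 1 this is p(p + 1)/2 = N(N - 1)/2 + 2N + 1. It is proved in doubled form, so that
  -- the truncating division meets an explicit multiple of 2.
  half-exponent : (suc N ℕ.* suc (suc N)) ℕ./ 2 ≡ triangle N ℕ.+ (suc N ℕ.+ N)
  half-exponent = ≡.trans (≡.cong (ℕ._/ 2) double) (m*n/n≡m (triangle N ℕ.+ (suc N ℕ.+ N)) 2)
    where
    open +-*-Solver using () renaming (solve to ℕ-solve; _:+_ to _⊞_; _:*_ to _⊠_; _:=_ to _≐_; con to num′)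
    double-triangle : ∀ N → triangle N ℕ.* 2 ℕ.+ N ≡ N ℕ.* N
    double-triangle zero    = ≡.refl
    double-triangle (suc N) = ≡.trans
      (ℕ-solve 2 (λ t N → (N ⊞ t) ⊠ num′ 2 ⊞ (num′ 1 ⊞ N) ≐ (t ⊠ num′ 2 ⊞ N) ⊞ (num′ 2 ⊠ N ⊞ num′ 1)) ≡.refl (triangle N) N)
      (≡.trans (≡.cong (ℕ._+ (2 ℕ.* N ℕ.+ 1)) (double-triangle N))
        (ℕ-solve 1 (λ N → N ⊠ N ⊞ (num′ 2 ⊠ N ⊞ num′ 1) ≐ (num′ 1 ⊞ N) ⊠ (num′ 1 ⊞ N)) ≡.refl N))
    double : suc N ℕ.* suc (suc N) ≡ (triangle N ℕ.+ (suc N ℕ.+ N)) ℕ.* 2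
    double = ≡.trans
      (ℕ-solve 1 (λ N → (num′ 1 ⊞ N) ⊠ (num′ 2 ⊞ N) ≐ N ⊠ N ⊞ (num′ 3 ⊠ N ⊞ num′ 2)) ≡.refl N)
      (≡.trans (≡.cong (ℕ._+ (3 ℕ.* N ℕ.+ 2)) (≡.sym (double-triangle N)))
        (ℕ-solve 2 (λ t N → (t ⊠ num′ 2 ⊞ N) ⊞ (num′ 3 ⊠ N ⊞ num′ 2) ≐ (t ⊞ ((num′ 1 ⊞ N) ⊞ N)) ⊠ num′ 2) ≡.refl (triangle N) N))

  rep-LHS : 2 < suc N → ∀ k ks → All (1 ≤_) (suc k ∷ ks) → LHS (suc N) n (suc k ∷ ks) represents 0#
  rep-LHS 2<p k ks ks>0 with odd-prime p-prime 2<p | dual-1∷ (suc k) ks | dualTable k ks ks>0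
  ... | h , N-even | j , l , eq , _ | T rewrite eq | half-exponent = rep-≈
    (rep-+ (rep-* (rep-qpow (triangle N ℕ.+ (suc N ℕ.+ N)))
                  (rep-sumBelow n λ a → rep-* (rep-^ a rep-qint) (rep-Hstar (replicate a 1 ++ suc k ∷ ks) ℕₚ.≤-refl)))
           (rep-sumBelow n λ a → rep-* (rep-^ a (rep-* rep-qinvp rep-qint)) (rep-HbarStar (replicate a 1 ++ j ∷ l) ℕₚ.≤-refl)))
    (series-duality q⁻¹ (proj₂ q-unit) n [p]ⁿ≈0 h N-even T)

-- The vanishing at all large primes

theorem5p4 : (ks : List ℕ) → ks ≢ [] → All (λ k → 1 ≤ k) ks →
    (n : ℕ) → ∃[ P₀ ] ((p : ℕ) → Prime p → P₀ < p → EqIn p n (LHS p n ks) 0F)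
theorem5p4 []            ks≢[] ks>0       n = contradiction ≡.refl ks≢[]
theorem5p4 (zero ∷ ks)   ks≢[] (() ∷ _)   n
-- The bound 2 excludes only the prime 2, for which p - 1 is odd, and serves every n at once.
theorem5p4 (suc k ∷ ks)  ks≢[] ks>0       n = 2 , λ where
  (suc N) p-prime 2<p → Residues.represents-0⇒EqIn (reduction (suc N) n) p-prime
    (Evaluation.rep-LHS p-prime (reduction (suc N) n) 2<p k ks ks>0)
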